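{- Any CONGEST algorithm (possibly randomized, succeeding with probability at least $2/3$) that solves Replacement Paths or Second Simple Shortest Path in directed unweighted $n$-vertex graphs of undirected diameter $D$ requires $\Omega\!\left(\frac{\sqrt{n}}{\log n}+D\right)$ rounds in the worst case, even when the given shortest path $P_{st}$ has a constant number of edges (in fact a single edge). The same lower bound holds for any algorithm computing an $\alpha$-approximation of RPaths or 2-SiSP, for any constant $\alpha>1$.
   Context: CONGEST model: the communication network is the graph $G=(V,E)$, $n=|V|$; each node has a unique identifier in $\{0,\dots,n-1\}$, knows its own and its neighbours' identifiers and its incident edges; computation proceeds in synchronous rounds in which each node may send a message of $O(\log n)$ bits to each neighbour; local computation is free; communication links are bidirectional even when $G$ is directed. The undirected diameter $D$ is the diameter of the underlying undirected unweighted graph of $G$. Replacement Paths (RPaths): given $G$, $s,t$, and a shortest $s$-$t$ path $P_{st}$, for each edge $e\in P_{st}$ some vertex must compute the weight of a shortest simple $s$-$t$ path $P_e$ avoiding $e$, and every vertex on $P_e$ must know its successor on $P_e$. Second Simple Shortest Path (2-SiSP): some vertex must compute the weight of a minimum-weight simple $s$-$t$ path not containing at least one edge of $P_{st}$, and each vertex on it must know its successor. An $\alpha$-approximation outputs, for each required path, a weight between the optimum and $\alpha$ times the optimum (with infinite weight when no such path exists).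
   Formalization: The bound is proved for all D with D = Ω(log n) and n − D = Ω(n), the hidden constant depending on those constants; for unrestricted D it fails, e.g. at D = n − 1 the graph is a path and no communication is needed. -}

module Defs where

open import Level using (0ℓ)
open import Data.Nat using (ℕ; zero; suc; _+_; _*_; _∸_; _^_; _≤_)
open import Data.Nat.Logarithm using (⌈log₂_⌉)
open import Data.Integer using (+_)
import Data.Rational as ℚ
open ℚ using (ℚ)
open import Data.Bool using (Bool; _∨_; if_then_else_)
open import Data.Fin using (Fin)
open import Data.Fin.Subset using (Subset) renaming (_∈_ to _∈ˢ_; _∉_ to _∉ˢ_)
open import Data.List using (List; []; _∷_; length)
open import Data.List.Membership.Propositional using (_∈_; _∉_)
open import Data.List.Relation.Unary.All using (All)
open import Data.List.Relation.Unary.Unique.Propositional using (Unique)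
open import Data.Maybe using (Maybe; just; nothing)
open import Data.Product using (Σ; ∃; ∃₂; _×_; _,_)
open import Data.Sum using (_⊎_)
open import Data.Vec using (Vec; lookup; tabulate)
open import Data.Vec.Bounded using (Vec≤)
open import Relation.Binary using (Rel)
open import Relation.Binary.Construct.Closure.ReflexiveTransitive using (Star; ε; _◅_)
open import Relation.Binary.PropositionalEquality using (_≡_)
open import Relation.Nullary using (¬_)

-- Vertices are their identifiers.  Antiparallel arcs are allowed.
record Digraph (n : ℕ) : Set where
  field
    out      : Fin n → Subset n
    loopless : ∀ v → v ∉ˢ out v

  Arc : Rel (Fin n) 0ℓ
  Arc u v = v ∈ˢ out u

  Link : Rel (Fin n) 0ℓ
  Link u v = Arc u v ⊎ Arc v u

  linked : Fin n → Fin n → Bool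
  linked u v = lookup (out u) v ∨ lookup (out v) u

  inn : Fin n → Subset n
  inn v = tabulate λ u → lookup (out u) v

open Digraph

module _ {V : Set} {R : Rel V 0ℓ} where

  vertices : ∀ {u v} → Star R u v → List V
  vertices {u} ε       = u ∷ []
  vertices {u} (_ ◅ w) = u ∷ vertices w

  arcs : ∀ {u v} → Star R u v → List (V × V)
  arcs ε                   = []
  arcs (_◅_ {u} {v} _ w) = (u , v) ∷ arcs w

  len : ∀ {u v} → Star R u v → ℕ
  len w = length (arcs w)

record Path {n} (G : Digraph n) (u v : Fin n) : Set where
  field
    walk   : Star (Arc G) u v
    simple : Unique (vertices walk)

open Path

edges : ∀ {n} {G : Digraph n} {u v} → Path G u v → List (Fin n × Fin n)
edges p = arcs (walk p)

∣_∣ᴾ : ∀ {n} {G : Digraph n} {u v} → Path G u v → ℕ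
∣ p ∣ᴾ = len (walk p)

-- In particular the underlying undirected graph is connected.
UndirectedDiameter : ∀ {n} → Digraph n → ℕ → Set
UndirectedDiameter {n} G D =
  (∀ u v → Σ (Star (Link G) u v) λ w → len w ≤ D) ×
  (∃₂ λ u v → (w : Star (Link G) u v) → D ≤ len w)

record Instance (n : ℕ) : Set where
  field
    graph    : Digraph n
    s t      : Fin n
    Pst      : Path graph s t
    shortest : (q : Path graph s t) → ∣ Pst ∣ᴾ ≤ ∣ q ∣ᴾ

open Instance

data Weight : Set where
  fin : ℕ → Weight
  ∞   : Weight

module _ {n} {G : Digraph n} {u v : Fin n} (C : Path G u v → Set) where

  Minimal : Path G u v → Set
  Minimal p = C p × (∀ q → C q → ∣ p ∣ᴾ ≤ ∣ q ∣ᴾ)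

  data IsOpt : Weight → Set where
    attained : ∀ p → Minimal p → IsOpt (fin ∣ p ∣ᴾ)
    none     : (∀ p → ¬ C p) → IsOpt ∞

data Within (α : ℚ) : (opt w : Weight) → Set where
  fin : ∀ {opt w} → opt ≤ w →
        (+ w) ℚ./ 1 ℚ.≤ α ℚ.* ((+ opt) ℚ./ 1) →
        Within α (fin opt) (fin w)
  ∞   : Within α ∞ ∞

-- What a vertex outputs about one required path.
record Report (n : ℕ) : Set where
  field
    weight : Maybe Weight
    next   : Maybe (Fin n)

open Report

-- Some vertex announces a weight.  Every announcement has to be good:
-- otherwise vertex i could announce i, and some vertex would always be right.
Computed : ∀ {n} → (Weight → Set) → (Fin n → Report n) → Set
Computed Good r =
  (∃₂ λ v w → weight (r v) ≡ just w) ×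
  (∀ v w → weight (r v) ≡ just w → Good w)

module _ {n} {G : Digraph n} {u v : Fin n} (C : Path G u v → Set) where

  -- All vertices must agree on a single optimal path, when one exists.
  Exact : (Fin n → Report n) → Set
  Exact r =
    Computed (IsOpt C) r ×
    (∃ C → Σ (Path G u v) λ p → Minimal C p ×
       (∀ {x y} → (x , y) ∈ edges p → next (r x) ≡ just y))

  Approx : ℚ → (Fin n → Report n) → Set
  Approx α = Computed λ w → ∃ λ opt → IsOpt C opt × Within α opt w

module _ {n} (I : Instance n) where

  Avoids : Fin n × Fin n → Path (graph I) (s I) (t I) → Set
  Avoids e p = e ∉ edges p

  AvoidsSome : Path (graph I) (s I) (t I) → Set
  AvoidsSome p = ∃ λ e → e ∈ edges (Pst I) × Avoids e p

record Problem : Set₁ where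
  field
    Out     : ℕ → Set
    Correct : ∀ {n} → Instance n → (Fin n → Out n) → Set

-- For RPaths a vertex outputs one report for each edge; only the reports
-- for edges of Pst matter.
RPaths 2-SiSP : Problem
RPaths = record
  { Out     = λ n → Fin n × Fin n → Report n
  ; Correct = λ I o → ∀ e → e ∈ edges (Pst I) → Exact (Avoids I e) λ v → o v e
  }
2-SiSP = record
  { Out     = Report
  ; Correct = λ I → Exact (AvoidsSome I)
  }

ApproxRPaths Approx2-SiSP : ℚ → Problem
ApproxRPaths α = record
  { Out     = λ n → Fin n × Fin n → Report n
  ; Correct = λ I o → ∀ e → e ∈ edges (Pst I) → Approx (Avoids I e) α λ v → o v e
  }
Approx2-SiSP α = record
  { Out     = Report
  ; Correct = λ I → Approx (AvoidsSome I) α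
  }

-- Initial knowledge of a vertex.  Outgoing and incoming arcs together give
-- the identifiers of all its neighbours in the communication network.
record View (n : ℕ) : Set where
  field
    self          : Fin n
    outArcs inArcs : Subset n
    source target : Fin n
    pathEdges     : List (Fin n × Fin n)

view : ∀ {n} → Instance n → Fin n → View n
view I v = record
  { self      = v
  ; outArcs   = out (graph I) v
  ; inArcs    = inn (graph I) v
  ; source    = s I
  ; target    = t I
  ; pathEdges = edges (Pst I)
  }

-- n vertices, messages of at most B bits, r private random bits per vertex.
record Protocol (n B r : ℕ) (O : Set) : Set₁ where
  field
    State  : Set
    init   : View n → Vec Bool r → State
    send   : State → Fin n → Vec≤ Bool B
    step   : State → Vec (Maybe (Vec≤ Bool B)) n → State
    output : State → O

Coins : ℕ → ℕ → Set
Coins n r = Vec (Vec Bool r) n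

module _ {n B r O} (A : Protocol n B r O) (I : Instance n) (ω : Coins n r) where
  open Protocol A

  stateAfter : ℕ → Fin n → State
  stateAfter zero    v = init (view I v) (lookup ω v)
  stateAfter (suc k) v = step (stateAfter k v) (tabulate λ u →
    if linked (graph I) u v then just (send (stateAfter k u) v) else nothing)

  outputAfter : ℕ → Fin n → O
  outputAfter T v = output (stateAfter T v)

-- Under uniform coins the event has probability at least 2/3: it contains
-- at least two thirds of the 2^(rn) outcomes.
Prob≥⅔ : ∀ {n r} → (Coins n r → Set) → Set
Prob≥⅔ {n} {r} E = ∃ λ (ωs : List (Coins n r)) →
  Unique ωs × All E ωs × 2 * (2 ^ r) ^ n ≤ 3 * length ωs

SolvesWithin : ∀ (Π : Problem) {n B r} → Protocol n B r (Problem.Out Π n) →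
               (T : ℕ) → (Instance n → Set) → Set
SolvesWithin Π A T Class = ∀ I → Class I →
  Prob≥⅔ λ ω → Problem.Correct Π I (outputAfter A I ω T)

SingleEdge : ∀ {n} → ℕ → Instance n → Set
SingleEdge D I = UndirectedDiameter (graph I) D × ∣ Pst I ∣ᴾ ≡ 1

-- √n / ⌈log₂ n⌉ + D ≤ x, with the division and the root cleared.
√_/log+_≤_ : ℕ → ℕ → ℕ → Set
√ n /log+ D ≤ x = D ≤ x × n ≤ ((x ∸ D) * ⌈log₂ n ⌉) ^ 2

-- The bandwidth is β⌈log₂ n⌉ and the hidden constant is 1/c.  The bound is
-- claimed for each pair n, D with D = Ω(log n) and n - D = Ω(n) (with
-- constant 1/k).  Without restrictions it is false: a graph with D = n - 1 is
-- a path, where a single edge Pst has no replacement and no communication is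
-- needed, and D = 1 is the congested clique, where reachability is faster.
LowerBound : Problem → Set₁
LowerBound Π =
  ∀ (β k : ℕ) → ∃₂ λ (c n₀ : ℕ) →
  ∀ (n D T r : ℕ) → n₀ ≤ n → ⌈log₂ n ⌉ ≤ k * D → n ≤ k * (n ∸ D) →
  (A : Protocol n (β * ⌈log₂ n ⌉) r (Problem.Out Π n)) →
  SolvesWithin Π A T (SingleEdge D) →
  √ n /log+ D ≤ (c * T)

module Submission where

-- The inner product mod 2 of x and y in {0,1}^K is reduced to the existence of
-- a directed s-t path avoiding the edge st.  A walk from s passes K times from
-- a first to a last column of L vertices and back; its track carries the
-- partial inner product, the arcs between tracks depend on x in the first
-- column and on y in the last one, and no other walk from s exists.  A spine
-- with arcs directed towards the columns, and so useless for walks from s,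
-- connects the columns and sets the undirected diameter.
--
-- The owner of x can simulate a region that shrinks by a column from the right
-- in each round, the owner of y one that shrinks from the left.  For fewer than
-- about L/2 rounds the regions cover the network, and the players exchange only
-- the messages from spine vertices outside a region to their parents inside it.
-- So the transcript has few bits, its fibres are rectangles, and it determines
-- the output; by Lindsey's lemma it must have about K/2 bits if the answer is
-- right for two thirds of the pairs (x, y).
--
-- With a path as the spine no messages cross, K = 8 suffices, and L = Ω(D).
-- With a tree of bounded degree and L leaves there are O(log L) messages per
-- round, and K of order L log² n gives L of order √n / log n.

open import Defs
open import Level using (0ℓ)
open import Data.Bool using (Bool; true; false; _∧_; _∨_; _xor_; if_then_else_)
import Data.Bool.Properties as Bool
open import Data.Empty using (⊥)
open import Data.Fin as Fin using (Fin; zero; suc; toℕ; fromℕ; fromℕ<; inject₁)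
import Data.Fin.Properties as Fin
open import Data.Fin.Induction using (<-weakInduction)
open import Data.List as List using (List; []; _∷_; length)
open import Data.List.Membership.Propositional using (_∈_; _∉_)
open import Data.List.Membership.DecPropositional using () renaming (_∈?_ to member?)
open import Data.List.Relation.Unary.All as All using (All; []; _∷_)
import Data.List.Relation.Unary.All.Properties as All
open import Data.List.Relation.Unary.AllPairs using ([]; _∷_)
open import Data.List.Relation.Unary.Any using (here; there; any?)
open import Data.List.Relation.Unary.Unique.Propositional using (Unique)
open import Data.Maybe as Maybe using (Maybe; just; nothing)
import Data.Maybe.Properties as Maybe
open import Data.Nat as ℕ using (ℕ; zero; suc)
import Data.Nat.Properties as ℕ
open import Data.Nat.Divisibility using (n∣m*n)
open import Data.Nat.DivMod using (_/_; _%_; _mod_; m%n<n; m<n⇒m%n≡m; m≡m%n+[m/n]*n; m<n*o⇒m/o<n; [m+kn]%n≡m%n; +-distrib-/-∣ʳ; m*n/n≡m; m/n*n≤m; m<n⇒m/n≡0)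
open import Data.Nat.Logarithm using (⌈log₂_⌉; ⌈log₂⌉-mono-≤; ⌈log₂2^n⌉≡n)
import Data.Nat.Tactic.RingSolver as ℕ-Solver
open import Data.Product using (Σ; ∃; ∃₂; _×_; _,_; proj₁; proj₂)
open import Data.Product.Function.NonDependent.Propositional using (_×-↔_)
import Data.Product.Properties as Product
open import Data.Sum as Sum using (_⊎_; inj₁; inj₂)
open import Data.Sum.Function.Propositional using (_⊎-↔_)
import Data.Sum.Properties as Sum
open import Data.Unit using (⊤; tt)
open import Data.Vec as Vec using (Vec; []; _∷_; _++_; lookup; tabulate)
import Data.Vec.Properties as Vec
open import Data.Vec.Bounded as Vec≤ using (Vec≤)
open import Function using (_∘_; id; mk⇔; _↔_; Inverse)
open import Function.Properties.Inverse using (↔-refl; ↔-sym; ↔-trans)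
open import Relation.Binary using (Rel; DecidableEquality; Symmetric)
open import Relation.Binary.Construct.Closure.ReflexiveTransitive using (Star; ε; _◅_; _◅◅_; gmap)
open import Relation.Binary.PropositionalEquality using (_≡_; _≢_; refl; sym; trans; cong; cong₂; subst; subst₂; module ≡-Reasoning)
open import Relation.Nullary using (¬_; Dec; yes; no; does; contradiction)
open import Relation.Nullary.Decidable using (map′; _×-dec_; _⊎-dec_; does-⇔; dec-true; dec-false)

-- Whether a detour exists is a question of reachability, and the answer separates finite from
-- infinite weights; so one family of graphs serves the exact and the approximate versions of both
-- problems. The tracks are the states of a branching program that reads the pairs of bits in order:
-- two states between pairs and four inside a pair, hence 6K + 2 tracks. The inner product suits
-- protocols that may err: its sign matrix is a Hadamard matrix, and every estimate becomes one
-- about squares of integers, free of roots.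
--
-- One spine is not enough. The feeds of a tree force K to grow with L, and then only about sqrt n /
-- log n columns fit into n vertices; for larger D more columns are needed, and a path, which allows
-- a constant K, provides them. As the bound is claimed for each pair n, D, a tail and single pad
-- vertices at the root of the spine adjust both numbers exactly.

module Discrepancy where

  open import Data.Integer using (ℤ; 0ℤ; 1ℤ; -1ℤ; +_; _+_; _*_; _≤_; -_; +≤+; -≤+)
  import Data.Integer as ℤ
  import Data.Integer.Properties as ℤ
  open import Data.Integer.Tactic.RingSolver using (solve-∀)
  open import Data.List using (cartesianProductWith)
  open import Data.List.Membership.Propositional using (lose; find)
  open import Data.List.Membership.Propositional.Properties using (∈-cartesianProductWith⁺)
  open import Data.List.Properties using (length-++; length-map)

  -- Finite sums of integers and enumerations.

  ∑ : {A : Set} → List A → (A → ℤ) → ℤ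
  ∑ []       f = 0ℤ
  ∑ (a ∷ as) f = f a + ∑ as f

  ∑-cong : {A : Set} (as : List A) {f g : A → ℤ} → (∀ a → f a ≡ g a) → ∑ as f ≡ ∑ as g
  ∑-cong []       f≗g = refl
  ∑-cong (a ∷ as) f≗g = cong₂ _+_ (f≗g a) (∑-cong as f≗g)

  ∑-mono : {A : Set} (as : List A) {f g : A → ℤ} → (∀ a → f a ≤ g a) → ∑ as f ≤ ∑ as g
  ∑-mono []       f≤g = ℤ.≤-refl
  ∑-mono (a ∷ as) f≤g = ℤ.+-mono-≤ (f≤g a) (∑-mono as f≤g)

  ∑-zero : {A : Set} (as : List A) → ∑ as (λ _ → 0ℤ) ≡ 0ℤ
  ∑-zero []       = refl
  ∑-zero (_ ∷ as) = trans (ℤ.+-identityˡ _) (∑-zero as)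

  ∑-+ : {A : Set} (as : List A) (f g : A → ℤ) → ∑ as (λ a → f a + g a) ≡ ∑ as f + ∑ as g
  ∑-+ []       f g = refl
  ∑-+ (a ∷ as) f g = trans (cong (_+_ (f a + g a)) (∑-+ as f g)) (interchange (f a) (g a) (∑ as f) (∑ as g))
    where
    interchange : ∀ p q r s → p + q + (r + s) ≡ p + r + (q + s)
    interchange = solve-∀

  ∑-*ˡ : {A : Set} (as : List A) (c : ℤ) (f : A → ℤ) → ∑ as (λ a → c * f a) ≡ c * ∑ as f
  ∑-*ˡ []       c f = sym (ℤ.*-zeroʳ c)
  ∑-*ˡ (a ∷ as) c f = trans (cong (_+_ (c * f a)) (∑-*ˡ as c f)) (sym (ℤ.*-distribˡ-+ c (f a) (∑ as f)))

  ∑-swap : {A B : Set} (as : List A) (bs : List B) (f : A → B → ℤ) →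
           ∑ as (λ a → ∑ bs (f a)) ≡ ∑ bs (λ b → ∑ as λ a → f a b)
  ∑-swap []       bs f = sym (∑-zero bs)
  ∑-swap (a ∷ as) bs f = trans (cong (_+_ (∑ bs (f a))) (∑-swap as bs f))
                               (sym (∑-+ bs (f a) (λ b → ∑ as λ a → f a b)))

  ∑-++ : {A : Set} (as bs : List A) (f : A → ℤ) → ∑ (as List.++ bs) f ≡ ∑ as f + ∑ bs f
  ∑-++ []       bs f = sym (ℤ.+-identityˡ _)
  ∑-++ (a ∷ as) bs f = trans (cong (_+_ (f a)) (∑-++ as bs f)) (sym (ℤ.+-assoc (f a) (∑ as f) (∑ bs f)))

  ∑-map : {A B : Set} (h : A → B) (as : List A) (f : B → ℤ) → ∑ (List.map h as) f ≡ ∑ as (f ∘ h)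
  ∑-map h []       f = refl
  ∑-map h (a ∷ as) f = cong (_+_ (f (h a))) (∑-map h as f)

  ∑-const : {A : Set} (as : List A) (c : ℤ) → ∑ as (λ _ → c) ≡ + length as * c
  ∑-const []       c = sym (ℤ.*-zeroˡ c)
  ∑-const (_ ∷ as) c = trans (cong (_+_ c) (∑-const as c)) (1+ (+ length as) c)
    where
    1+ : ∀ l c → c + l * c ≡ (1ℤ + l) * c
    1+ = solve-∀

  vecs : {A : Set} → List A → ∀ n → List (Vec A n)
  vecs as zero    = [] ∷ []
  vecs as (suc n) = cartesianProductWith _∷_ as (vecs as n)

  ∑-product : {A B C : Set} (h : A → B → C) (as : List A) (bs : List B) (f : C → ℤ) →
              ∑ (cartesianProductWith h as bs) f ≡ ∑ as λ a → ∑ bs λ b → f (h a b)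
  ∑-product h []       bs f = refl
  ∑-product h (a ∷ as) bs f =
    trans (∑-++ (List.map (h a) bs) _ f) (cong₂ _+_ (∑-map (h a) bs f) (∑-product h as bs f))

  length-vecs : {A : Set} (as : List A) (n : ℕ) → length (vecs as n) ≡ length as ℕ.^ n
  length-vecs as zero    = refl
  length-vecs as (suc n) =
    trans (length-product as (vecs as n)) (cong (length as ℕ.*_) (length-vecs as n))
    where
    length-product : ∀ as bs → length (cartesianProductWith Vec._∷_ as bs) ≡ length as ℕ.* length bs
    length-product []       bs = refl
    length-product (a ∷ as) bs = trans (length-++ (List.map (a Vec.∷_) bs))
      (cong₂ ℕ._+_ (length-map (a Vec.∷_) bs) (length-product as bs))

  ⟦_⟧ : Bool → ℤ
  ⟦ true  ⟧ = 1ℤ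
  ⟦ false ⟧ = 0ℤ

  ⟦∧⟧ : ∀ p q → ⟦ p ∧ q ⟧ ≡ ⟦ p ⟧ * ⟦ q ⟧
  ⟦∧⟧ true  q = sym (ℤ.*-identityˡ ⟦ q ⟧)
  ⟦∧⟧ false q = refl

  -- Every element is listed exactly once.
  Enumerates : {A : Set} → DecidableEquality A → List A → Set
  Enumerates {A} _≟_ as = ∀ a₀ (h : A → ℤ) → ∑ as (λ a → ⟦ does (a₀ ≟ a) ⟧ * h a) ≡ h a₀

  bools : List Bool
  bools = false ∷ true ∷ []

  bools-enumerates : Enumerates Bool._≟_ bools
  bools-enumerates false h = first (h false) (h true)
    where
    first : ∀ p q → 1ℤ * p + (0ℤ * q + 0ℤ) ≡ p
    first = solve-∀
  bools-enumerates true  h = second (h false) (h true)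
    where
    second : ∀ p q → 0ℤ * p + (1ℤ * q + 0ℤ) ≡ q
    second = solve-∀

  vecs-enumerates : {A : Set} (_≟_ : DecidableEquality A) {as : List A} → Enumerates _≟_ as →
                    ∀ n → Enumerates (Vec.≡-dec _≟_) (vecs as n)
  vecs-enumerates _≟_ {as} enum zero    []       h =
    trans (ℤ.+-identityʳ _) (ℤ.*-identityˡ (h []))
  vecs-enumerates _≟_ {as} enum (suc n) (a₀ ∷ v₀) h = begin
    ∑ (vecs as (suc n)) (λ v → ⟦ does (Vec.≡-dec _≟_ (a₀ ∷ v₀) v) ⟧ * h v)
      ≡⟨ ∑-product _∷_ as (vecs as n) _ ⟩
    ∑ as (λ a → ∑ (vecs as n) λ v → ⟦ does (a₀ ≟ a) ∧ does (Vec.≡-dec _≟_ v₀ v) ⟧ * h (a ∷ v))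
      ≡⟨ ∑-cong as (λ a → trans
           (∑-cong (vecs as n) λ v → trans
             (cong (_* h (a ∷ v)) (⟦∧⟧ (does (a₀ ≟ a)) (does (Vec.≡-dec _≟_ v₀ v))))
             (ℤ.*-assoc ⟦ does (a₀ ≟ a) ⟧ _ _))
           (∑-*ˡ (vecs as n) ⟦ does (a₀ ≟ a) ⟧ _)) ⟩
    ∑ as (λ a → ⟦ does (a₀ ≟ a) ⟧ * ∑ (vecs as n) λ v → ⟦ does (Vec.≡-dec _≟_ v₀ v) ⟧ * h (a ∷ v))
      ≡⟨ ∑-cong as (λ a → cong (⟦ does (a₀ ≟ a) ⟧ *_) (vecs-enumerates _≟_ enum n v₀ (λ v → h (a ∷ v)))) ⟩
    ∑ as (λ a → ⟦ does (a₀ ≟ a) ⟧ * h (a ∷ v₀))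
      ≡⟨ enum a₀ (λ a → h (a ∷ v₀)) ⟩
    h (a₀ ∷ v₀) ∎
    where open ≡-Reasoning

  Bits : ℕ → Set
  Bits = Vec Bool

  _≟ᵇ_ : ∀ {K} → DecidableEquality (Bits K)
  _≟ᵇ_ = Vec.≡-dec Bool._≟_

  bits : ∀ K → List (Bits K)
  bits = vecs bools

  ∑-bits : ∀ K (f : Bits (suc K) → ℤ) →
           ∑ (bits (suc K)) f ≡ ∑ (bits K) (f ∘ (false ∷_)) + ∑ (bits K) (f ∘ (true ∷_))
  ∑-bits K f = trans (∑-product _∷_ bools (bits K) f) (cong (_+_ (∑ (bits K) (f ∘ (false ∷_)))) (ℤ.+-identityʳ _))

  2^ : ℕ → ℤ
  2^ K = + (2 ℕ.^ K)

  2^-suc : ∀ K → 2^ (suc K) ≡ + 2 * 2^ K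
  2^-suc K = ℤ.pos-* 2 (2 ℕ.^ K)

  ∑-bits-const : ∀ K c → ∑ (bits K) (λ _ → c) ≡ 2^ K * c
  ∑-bits-const K c = trans (∑-const (bits K) c) (cong (λ l → + l * c) (length-vecs bools K))

  -- Cauchy-Schwarz, the Hadamard matrix and Lindsey's lemma.

  sq : ℤ → ℤ
  sq i = i * i

  0≤sq : ∀ i → 0ℤ ≤ sq i
  0≤sq (+ m)      = subst (0ℤ ≤_) (ℤ.pos-* m m) (+≤+ ℕ.z≤n)
  0≤sq (ℤ.-[1+ m ]) = +≤+ ℕ.z≤n

  *-monoˡ : ∀ m {i j} → i ≤ j → + m * i ≤ + m * j
  *-monoˡ m = ℤ.*-monoˡ-≤-nonNeg (+ m)

  parallelogram : ∀ i j → sq (i + j) + sq (i ℤ.- j) ≡ + 2 * (sq i + sq j)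
  parallelogram = expand
    where
    expand : ∀ i j → (i + j) * (i + j) + (i ℤ.- j) * (i ℤ.- j) ≡ + 2 * (i * i + j * j)
    expand = solve-∀

  sq-sum≤ : ∀ i j → sq (i + j) ≤ + 2 * (sq i + sq j)
  sq-sum≤ i j = subst (sq (i + j) ≤_) (parallelogram i j)
    (ℤ.i≤i+j (sq (i + j)) (sq (i ℤ.- j)) {{ℤ.nonNegative (0≤sq (i ℤ.- j))}})

  -- Induction over the two halves of the cube; `sq-sum≤` joins them at the price of the factor 2 by
  -- which the cube grows.
  cauchy-schwarz : ∀ K (f : Bits K → ℤ) → sq (∑ (bits K) f) ≤ 2^ K * ∑ (bits K) (sq ∘ f)
  cauchy-schwarz zero    f = ℤ.≤-reflexive (square (f []))
    where
    square : ∀ i → (i + 0ℤ) * (i + 0ℤ) ≡ 1ℤ * (i * i + 0ℤ)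
    square = solve-∀
  cauchy-schwarz (suc K) f = begin
    sq (∑ (bits (suc K)) f)                       ≡⟨ cong sq (∑-bits K f) ⟩
    sq (S f₀ + S f₁)                              ≤⟨ sq-sum≤ (S f₀) (S f₁) ⟩
    + 2 * (sq (S f₀) + sq (S f₁))                 ≤⟨ *-monoˡ 2 (ℤ.+-mono-≤ (cauchy-schwarz K f₀) (cauchy-schwarz K f₁)) ⟩
    + 2 * (2^ K * S (sq ∘ f₀) + 2^ K * S (sq ∘ f₁)) ≡⟨ factor (2^ K) (S (sq ∘ f₀)) (S (sq ∘ f₁)) ⟩
    + 2 * 2^ K * (S (sq ∘ f₀) + S (sq ∘ f₁))      ≡⟨ cong₂ _*_ (2^-suc K) (∑-bits K (sq ∘ f)) ⟨
    2^ (suc K) * ∑ (bits (suc K)) (sq ∘ f)        ∎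
    where
    open ℤ.≤-Reasoning
    S  = ∑ (bits K)
    f₀ = f ∘ (false ∷_)
    f₁ = f ∘ (true ∷_)
    factor : ∀ p q r → + 2 * (p * q + p * r) ≡ + 2 * p * (q + r)
    factor = solve-∀

  dot : ∀ {K} → Bits K → Bits K → Bool
  dot []      []      = false
  dot (a ∷ x) (b ∷ y) = (a ∧ b) xor dot x y

  sgn : Bool → ℤ
  sgn false = 1ℤ
  sgn true  = -1ℤ

  sgn-xor : ∀ p q → sgn (p xor q) ≡ sgn p * sgn q
  sgn-xor false q     = sym (ℤ.*-identityˡ (sgn q))
  sgn-xor true  false = refl
  sgn-xor true  true  = refl

  sq-sgn : ∀ p → sq (sgn p) ≡ 1ℤ
  sq-sgn false = refl
  sq-sgn true  = refl

  χ : ∀ {K} → Bits K → Bits K → ℤ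
  χ x y = sgn (dot x y)

  -- The matrix of all `χ x y` is Sylvester's Hadamard matrix, with blocks H, H, H, -H. So the
  -- transforms of the two halves of `v` appear as a sum and as a difference, and the parallelogram
  -- law closes the induction.
  parseval : ∀ K (v : Bits K → ℤ) →
    ∑ (bits K) (λ x → sq (∑ (bits K) λ y → v y * χ x y)) ≡ 2^ K * ∑ (bits K) (sq ∘ v)
  parseval zero    v = square (v [])
    where
    square : ∀ i → (i * 1ℤ + 0ℤ) * (i * 1ℤ + 0ℤ) + 0ℤ ≡ 1ℤ * (i * i + 0ℤ)
    square = solve-∀
  parseval (suc K) v = begin
    ∑ (bits (suc K)) (λ x → sq (∑ (bits (suc K)) λ y → v y * χ x y))
      ≡⟨ ∑-bits K _ ⟩
    S (λ x → sq (∑ (bits (suc K)) λ y → v y * χ (false ∷ x) y)) +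
    S (λ x → sq (∑ (bits (suc K)) λ y → v y * χ (true ∷ x) y))
      ≡⟨ cong₂ _+_ (∑-cong (bits K) (cong sq ∘ split₀)) (∑-cong (bits K) (cong sq ∘ split₁)) ⟩
    S (λ x → sq (W v₀ x + W v₁ x)) + S (λ x → sq (W v₀ x ℤ.- W v₁ x))
      ≡⟨ ∑-+ (bits K) _ _ ⟨
    S (λ x → sq (W v₀ x + W v₁ x) + sq (W v₀ x ℤ.- W v₁ x))
      ≡⟨ ∑-cong (bits K) (λ x → parallelogram (W v₀ x) (W v₁ x)) ⟩
    S (λ x → + 2 * (sq (W v₀ x) + sq (W v₁ x)))
      ≡⟨ ∑-*ˡ (bits K) (+ 2) _ ⟩
    + 2 * S (λ x → sq (W v₀ x) + sq (W v₁ x))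
      ≡⟨ cong (+ 2 *_) (∑-+ (bits K) _ _) ⟩
    + 2 * (S (sq ∘ W v₀) + S (sq ∘ W v₁))
      ≡⟨ cong (+ 2 *_) (cong₂ _+_ (parseval K v₀) (parseval K v₁)) ⟩
    + 2 * (2^ K * S (sq ∘ v₀) + 2^ K * S (sq ∘ v₁))
      ≡⟨ factor (2^ K) (S (sq ∘ v₀)) (S (sq ∘ v₁)) ⟩
    + 2 * 2^ K * (S (sq ∘ v₀) + S (sq ∘ v₁))
      ≡⟨ cong₂ _*_ (2^-suc K) (∑-bits K (sq ∘ v)) ⟨
    2^ (suc K) * ∑ (bits (suc K)) (sq ∘ v) ∎
    where
    open ≡-Reasoning
    S  = ∑ (bits K)
    v₀ = v ∘ (false ∷_)
    v₁ = v ∘ (true ∷_)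
    W : (Bits K → ℤ) → Bits K → ℤ
    W u x = S λ y → u y * χ x y
    split₀ : ∀ x → ∑ (bits (suc K)) (λ y → v y * χ (false ∷ x) y) ≡ W v₀ x + W v₁ x
    split₀ x = ∑-bits K _
    split₁ : ∀ x → ∑ (bits (suc K)) (λ y → v y * χ (true ∷ x) y) ≡ W v₀ x ℤ.- W v₁ x
    split₁ x = trans (∑-bits K _) (cong (_+_ (W v₀ x)) (begin
      S (λ y → v₁ y * sgn (true xor dot x y))
        ≡⟨ ∑-cong (bits K) (λ y → trans (cong (v₁ y *_) (sgn-xor true (dot x y))) (flip (v₁ y) (χ x y))) ⟩
      S (λ y → -1ℤ * (v₁ y * χ x y)) ≡⟨ ∑-*ˡ (bits K) -1ℤ _ ⟩
      -1ℤ * W v₁ x                   ≡⟨ ℤ.-1*i≡-i (W v₁ x) ⟩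
      - W v₁ x                       ∎))
      where
      flip : ∀ p q → p * (-1ℤ * q) ≡ -1ℤ * (p * q)
      flip = solve-∀
    factor : ∀ p q r → + 2 * (p * q + p * r) ≡ + 2 * p * (q + r)
    factor = solve-∀

  ∈-bools : ∀ b → b ∈ bools
  ∈-bools false = here refl
  ∈-bools true  = there (here refl)

  ∈-bits : ∀ {K} (x : Bits K) → x ∈ bits K
  ∈-bits []      = here refl
  ∈-bits (b ∷ x) = ∈-cartesianProductWith⁺ _∷_ (∈-bools b) (∈-bits x)

  sq-⟦⟧* : ∀ p i → sq (⟦ p ⟧ * i) ≤ sq i
  sq-⟦⟧* true  i = ℤ.≤-reflexive (cong sq (ℤ.*-identityˡ i))
  sq-⟦⟧* false i = 0≤sq i

  sq-sgn* : ∀ p i → sq (sgn p * i) ≡ sq i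
  sq-sgn* p i = trans (regroup (sgn p) i) (trans (cong (_* sq i) (sq-sgn p)) (ℤ.*-identityˡ (sq i)))
    where
    regroup : ∀ a i → a * i * (a * i) ≡ a * a * (i * i)
    regroup = solve-∀

  -- Lindsey's lemma.
  rectangle-sum : ∀ K (u v : Bits K → Bool) →
    sq (∑ (bits K) λ x → ⟦ u x ⟧ * ∑ (bits K) λ y → ⟦ v y ⟧ * χ x y) ≤ 2^ K * (2^ K * 2^ K)
  rectangle-sum K u v = begin
    sq (∑ (bits K) λ x → ⟦ u x ⟧ * V x)               ≤⟨ cauchy-schwarz K _ ⟩
    2^ K * ∑ (bits K) (λ x → sq (⟦ u x ⟧ * V x))       ≤⟨ *-monoˡ (2 ℕ.^ K) (∑-mono (bits K) λ x → sq-⟦⟧* (u x) (V x)) ⟩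
    2^ K * ∑ (bits K) (sq ∘ V)                         ≡⟨ cong (2^ K *_) (parseval K (⟦_⟧ ∘ v)) ⟩
    2^ K * (2^ K * ∑ (bits K) (λ y → sq ⟦ v y ⟧))
      ≤⟨ *-monoˡ (2 ℕ.^ K) (*-monoˡ (2 ℕ.^ K) (∑-mono (bits K) (sq⟦⟧≤1 ∘ v))) ⟩
    2^ K * (2^ K * ∑ (bits K) (λ _ → 1ℤ))
      ≡⟨ cong (λ s → 2^ K * (2^ K * s)) (trans (∑-bits-const K 1ℤ) (ℤ.*-identityʳ (2^ K))) ⟩
    2^ K * (2^ K * 2^ K)                               ∎
    where
    open ℤ.≤-Reasoning
    V : Bits K → ℤ
    V x = ∑ (bits K) λ y → ⟦ v y ⟧ * χ x y
    sq⟦⟧≤1 : ∀ p → sq ⟦ p ⟧ ≤ 1ℤ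
    sq⟦⟧≤1 true  = ℤ.≤-refl
    sq⟦⟧≤1 false = +≤+ ℕ.z≤n

  -- Rectangular fibres and their correlation with the inner product.

  Exchange : {X Y P : Set} → (X → Y → P) → Set
  Exchange f = ∀ x y x′ y′ → f x y ≡ f x′ y′ → f x y′ ≡ f x y

  module _ {K c} (f : Bits K → Bits K → Bits c) (exchange : Exchange f) (g : Bits c → Bool) where

    private
      row? : ∀ p x → Dec _
      row? p x = any? (λ y → f x y ≟ᵇ p) (bits K)
      col? : ∀ p y → Dec _
      col? p y = any? (λ x → f x y ≟ᵇ p) (bits K)

      R : Bits c → ℤ
      R p = ∑ (bits K) λ x → ⟦ does (row? p x) ⟧ * ∑ (bits K) λ y → ⟦ does (col? p y) ⟧ * χ x y

    -- If `p` occurs in row `x`, at `y₁` say, and in column `y`, at `x₁` say, then `exchange` for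
    -- these two pairs puts `p` at the crossing of row and column.
    fibre-rectangle : ∀ p x y → ⟦ does (f x y ≟ᵇ p) ⟧ ≡ ⟦ does (row? p x) ⟧ * ⟦ does (col? p y) ⟧
    fibre-rectangle p x y = trans
      (cong ⟦_⟧ (does-⇔ (mk⇔ to from) (f x y ≟ᵇ p) (row? p x ×-dec col? p y)))
      (⟦∧⟧ (does (row? p x)) (does (col? p y)))
      where
      to : _ → _
      to fxy≡p = lose (∈-bits y) fxy≡p , lose (∈-bits x) fxy≡p
      from : _ → _
      from (row , col) with find row | find col
      ... | y₁ , _ , p₁ | x₁ , _ , p₂ = trans (exchange x y₁ x₁ y (trans p₁ (sym p₂))) p₁

    -- The number of pairs on which `g` answers correctly minus the number on which it errs.
    correlation : ℤ
    correlation = ∑ (bits K) λ x → ∑ (bits K) λ y → sgn (g (f x y)) * χ x y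

    correlation-fibres : correlation ≡ ∑ (bits c) λ p → sgn (g p) * R p
    correlation-fibres = begin
      S (λ x → S λ y → sgn (g (f x y)) * χ x y)
        ≡⟨ ∑-cong (bits K) (λ x → ∑-cong (bits K) λ y → by-fibre x y) ⟩
      S (λ x → S λ y → ∑ (bits c) λ p → sgn (g p) * (⟦ does (row? p x) ⟧ * (⟦ does (col? p y) ⟧ * χ x y)))
        ≡⟨ ∑-cong (bits K) (λ x → ∑-swap (bits K) (bits c) _) ⟩
      S (λ x → ∑ (bits c) λ p → S λ y → sgn (g p) * (⟦ does (row? p x) ⟧ * (⟦ does (col? p y) ⟧ * χ x y)))
        ≡⟨ ∑-swap (bits K) (bits c) _ ⟩
      ∑ (bits c) (λ p → S λ x → S λ y → sgn (g p) * (⟦ does (row? p x) ⟧ * (⟦ does (col? p y) ⟧ * χ x y)))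
        ≡⟨ ∑-cong (bits c) (λ p → trans
             (∑-cong (bits K) λ x → trans (∑-*ˡ (bits K) (sgn (g p)) _)
               (cong (sgn (g p) *_) (∑-*ˡ (bits K) ⟦ does (row? p x) ⟧ _)))
             (∑-*ˡ (bits K) (sgn (g p)) _)) ⟩
      ∑ (bits c) (λ p → sgn (g p) * R p) ∎
      where
      open ≡-Reasoning
      S = ∑ (bits K)
      regroup : ∀ a b s t → a * b * s * t ≡ s * (a * (b * t))
      regroup = solve-∀
      by-fibre : ∀ x y → sgn (g (f x y)) * χ x y ≡
        ∑ (bits c) λ p → sgn (g p) * (⟦ does (row? p x) ⟧ * (⟦ does (col? p y) ⟧ * χ x y))
      by-fibre x y = begin
        sgn (g (f x y)) * χ x y
          ≡⟨ cong (_* χ x y) (vecs-enumerates Bool._≟_ bools-enumerates c (f x y) (sgn ∘ g)) ⟨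
        ∑ (bits c) (λ p → ⟦ does (f x y ≟ᵇ p) ⟧ * sgn (g p)) * χ x y
          ≡⟨ ℤ.*-comm _ (χ x y) ⟩
        χ x y * ∑ (bits c) (λ p → ⟦ does (f x y ≟ᵇ p) ⟧ * sgn (g p))
          ≡⟨ ∑-*ˡ (bits c) (χ x y) _ ⟨
        ∑ (bits c) (λ p → χ x y * (⟦ does (f x y ≟ᵇ p) ⟧ * sgn (g p)))
          ≡⟨ ∑-cong (bits c) (λ p → trans
               (cong (λ i → χ x y * (i * sgn (g p))) (fibre-rectangle p x y))
               (reorder (χ x y) ⟦ does (row? p x) ⟧ ⟦ does (col? p y) ⟧ (sgn (g p)))) ⟩
        ∑ (bits c) (λ p → sgn (g p) * (⟦ does (row? p x) ⟧ * (⟦ does (col? p y) ⟧ * χ x y))) ∎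
        where
        reorder : ∀ t a b s → t * (a * b * s) ≡ s * (a * (b * t))
        reorder = solve-∀

    -- Lindsey's lemma bounds the square of each of the 2^c fibre sums; Cauchy-Schwarz over the
    -- fibres turns this into a bound for the square of their signed sum.
    correlation-bound : sq correlation ≤ 2^ c * (2^ c * (2^ K * (2^ K * 2^ K)))
    correlation-bound = begin
      sq correlation                                       ≡⟨ cong sq correlation-fibres ⟩
      sq (∑ (bits c) λ p → sgn (g p) * R p)                 ≤⟨ cauchy-schwarz c _ ⟩
      2^ c * ∑ (bits c) (λ p → sq (sgn (g p) * R p))
        ≡⟨ cong (2^ c *_) (∑-cong (bits c) λ p → sq-sgn* (g p) (R p)) ⟩
      2^ c * ∑ (bits c) (sq ∘ R)
        ≤⟨ *-monoˡ (2 ℕ.^ c) (∑-mono (bits c) λ p → rectangle-sum K (does ∘ row? p) (does ∘ col? p)) ⟩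
      2^ c * ∑ (bits c) (λ _ → 2^ K * (2^ K * 2^ K))        ≡⟨ cong (2^ c *_) (∑-bits-const c _) ⟩
      2^ c * (2^ c * (2^ K * (2^ K * 2^ K)))                ∎
      where open ℤ.≤-Reasoning

  -- Averaging over the coins.

  above-average : {A : Set} (as : List A) (h : A → ℤ) (q : ℤ) → 0 ℕ.< length as →
                  + length as * q ≤ ∑ as h → ∃ λ a → q ≤ h a
  above-average (a ∷ as) h q _ avg with q ℤ.≤? h a
  ... | yes q≤ha = a , q≤ha
  above-average (a ∷ [])      h q _ avg | no q≰ha =
    contradiction (subst₂ _≤_ (ℤ.*-identityˡ q) (ℤ.+-identityʳ (h a)) avg) q≰ha
  above-average (a ∷ b ∷ as) h q _ avg | no q≰ha =
    above-average (b ∷ as) h q (ℕ.s≤s ℕ.z≤n)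
      (ℤ.≮⇒≥ λ lt → ℤ.<⇒≱ (ℤ.+-mono-< (ℤ.≰⇒> q≰ha) lt)
        (ℤ.≤-trans (ℤ.≤-reflexive (1+ (+ length (b ∷ as)) q)) avg))
    where
    1+ : ∀ l q → q + l * q ≡ (1ℤ + l) * q
    1+ = solve-∀

  module _ {Ω : Set} (_≟_ : DecidableEquality Ω) where

    -- For a list without repetitions this is the indicator of membership. As a sum it turns the
    -- double counting of good coins into an exchange of sums.
    multiplicity : Ω → List Ω → ℤ
    multiplicity ω ωs = ∑ ωs λ ω′ → ⟦ does (ω′ ≟ ω) ⟧ * 1ℤ

    multiplicity-∉ : ∀ ω ωs → All (ω ≢_) ωs → multiplicity ω ωs ≡ 0ℤ
    multiplicity-∉ ω []        []           = refl
    multiplicity-∉ ω (ω′ ∷ ωs) (ω≢ω′ ∷ ω∉) =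
      cong₂ _+_ (cong (λ b → ⟦ b ⟧ * 1ℤ) (dec-false (ω′ ≟ ω) (ω≢ω′ ∘ sym))) (multiplicity-∉ ω ωs ω∉)

    multiplicity-unique : ∀ ω {ωs} → Unique ωs →
      multiplicity ω ωs ≡ 0ℤ ⊎ (multiplicity ω ωs ≡ 1ℤ × ω ∈ ωs)
    multiplicity-unique ω {[]}      []              = inj₁ refl
    multiplicity-unique ω {ω′ ∷ ωs} (ω′∉ ∷ unique) with ω′ ≟ ω
    ... | yes refl = inj₂ (cong (_+_ 1ℤ) (multiplicity-∉ ω ωs ω′∉) , here refl)
    ... | no _ with multiplicity-unique ω unique
    ...   | inj₁ m≡0       = inj₁ (trans (ℤ.+-identityˡ _) m≡0)
    ...   | inj₂ (m≡1 , ω∈) = inj₂ (trans (ℤ.+-identityˡ _) m≡1 , there ω∈)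

    ∑-multiplicity : ∀ {as} → Enumerates _≟_ as → ∀ ωs →
                     ∑ as (λ ω → multiplicity ω ωs) ≡ + length ωs
    ∑-multiplicity {as} enum ωs = begin
      ∑ as (λ ω → ∑ ωs λ ω′ → ⟦ does (ω′ ≟ ω) ⟧ * 1ℤ) ≡⟨ ∑-swap as ωs _ ⟩
      ∑ ωs (λ ω′ → ∑ as λ ω → ⟦ does (ω′ ≟ ω) ⟧ * 1ℤ) ≡⟨ ∑-cong ωs (λ ω′ → enum ω′ (λ _ → 1ℤ)) ⟩
      ∑ ωs (λ _ → 1ℤ)                                  ≡⟨ ∑-const ωs 1ℤ ⟩
      + length ωs * 1ℤ                                 ≡⟨ ℤ.*-identityʳ _ ⟩
      + length ωs                                      ∎
      where open ≡-Reasoning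

    -- Yao's principle for the uniform distribution on the inputs.
    module _ {as : List Ω} (enum : Enumerates _≟_ as) (nonempty : 0 ℕ.< length as)
             {K c} (f : Ω → Bits K → Bits K → Bits c) (exchange : ∀ ω → Exchange (f ω))
             (g : Bits c → Bool) (good : Bits K → Bits K → List Ω)
             (unique : ∀ x y → Unique (good x y))
             (likely : ∀ x y → 2 ℕ.* length as ℕ.≤ 3 ℕ.* length (good x y))
             (correct : ∀ x y {ω} → ω ∈ good x y → g (f ω x y) ≡ dot x y) where

      private
        SS : (Bits K → Bits K → ℤ) → ℤ
        SS h = ∑ (bits K) λ x → ∑ (bits K) (h x)

        SS-cong : ∀ {h h′} → (∀ x y → h x y ≡ h′ x y) → SS h ≡ SS h′
        SS-cong e = ∑-cong (bits K) λ x → ∑-cong (bits K) (e x)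
        SS-mono : ∀ {h h′} → (∀ x y → h x y ≤ h′ x y) → SS h ≤ SS h′
        SS-mono e = ∑-mono (bits K) λ x → ∑-mono (bits K) (e x)
        SS-*ˡ : ∀ a h → SS (λ x y → a * h x y) ≡ a * SS h
        SS-*ˡ a h = trans (∑-cong (bits K) λ x → ∑-*ˡ (bits K) a (h x)) (∑-*ˡ (bits K) a _)
        SS-+ : ∀ h h′ → SS (λ x y → h x y + h′ x y) ≡ SS h + SS h′
        SS-+ h h′ = trans (∑-cong (bits K) λ x → ∑-+ (bits K) (h x) (h′ x)) (∑-+ (bits K) _ _)
        N : ℤ
        N = 2^ K * 2^ K
        SS-const : ∀ a → SS (λ _ _ → a) ≡ N * a
        SS-const a = trans (∑-cong (bits K) λ _ → ∑-bits-const K a)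
                    (trans (∑-bits-const K _) (sym (ℤ.*-assoc (2^ K) (2^ K) a)))

        hits : Ω → ℤ
        hits ω = SS λ x y → multiplicity ω (good x y)

        -- Each pair has two thirds of the coins on its side, so some coins have two thirds of the
        -- pairs on theirs. Fixing them leaves a deterministic protocol.
        likely-point : ∃ λ ω → + 2 * N ≤ + 3 * hits ω
        likely-point = above-average as _ _ nonempty (begin
          + length as * (+ 2 * N)                      ≡⟨ swap (+ length as) N ⟩
          N * (+ 2 * + length as)                      ≡⟨ SS-const _ ⟨
          SS (λ _ _ → + 2 * + length as)               ≤⟨ SS-mono likelyᶻ ⟩
          SS (λ x y → + 3 * + length (good x y))       ≡⟨ SS-*ˡ (+ 3) _ ⟩
          + 3 * SS (λ x y → + length (good x y))
            ≡⟨ cong (+ 3 *_) (SS-cong λ x y → sym (∑-multiplicity {as} enum (good x y))) ⟩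
          + 3 * SS (λ x y → ∑ as λ ω → multiplicity ω (good x y))
            ≡⟨ cong (+ 3 *_) (trans (∑-cong (bits K) λ x → ∑-swap (bits K) as _) (∑-swap (bits K) as _)) ⟩
          + 3 * ∑ as hits                              ≡⟨ ∑-*ˡ as (+ 3) hits ⟨
          ∑ as (λ ω → + 3 * hits ω)                    ∎)
          where
          open ℤ.≤-Reasoning
          swap : ∀ l n → l * (+ 2 * n) ≡ n * (+ 2 * l)
          swap = solve-∀
          likelyᶻ : ∀ x y → + 2 * + length as ≤ + 3 * + length (good x y)
          likelyᶻ x y = ℤ.≤-trans (ℤ.≤-reflexive (sym (ℤ.pos-* 2 (length as))))
            (ℤ.≤-trans (+≤+ (likely x y)) (ℤ.≤-reflexive (ℤ.pos-* 3 (length (good x y)))))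

        -- The product of the signs is 1 for good coins, and -1 is a safe lower bound for all
        -- others.
        agreement : ∀ ω x y → + 2 * multiplicity ω (good x y) + -1ℤ ≤ sgn (g (f ω x y)) * χ x y
        agreement ω x y with multiplicity-unique ω (unique x y)
        ... | inj₁ m≡0 rewrite m≡0 = -1≤sgn (g (f ω x y)) (dot x y)
          where
          -1≤sgn : ∀ p q → -1ℤ ≤ sgn p * sgn q
          -1≤sgn false false = -≤+
          -1≤sgn false true  = ℤ.≤-refl
          -1≤sgn true  false = ℤ.≤-refl
          -1≤sgn true  true  = -≤+
        ... | inj₂ (m≡1 , ω∈) rewrite m≡1 | correct x y ω∈ = ℤ.≤-reflexive (sym (sq-sgn (dot x y)))

        -- Twice two thirds minus one is one third.
        advantage : ∀ ω → + 2 * N ≤ + 3 * hits ω → N ≤ + 3 * correlation (f ω) (exchange ω) g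
        advantage ω 2N≤3h = begin
          N                                            ≡⟨ 4-3 N ⟩
          + 2 * (+ 2 * N) + + 3 * (N * -1ℤ)            ≤⟨ ℤ.+-monoˡ-≤ _ (*-monoˡ 2 2N≤3h) ⟩
          + 2 * (+ 3 * hits ω) + + 3 * (N * -1ℤ)       ≡⟨ factor (hits ω) (N * -1ℤ) ⟩
          + 3 * (+ 2 * hits ω + N * -1ℤ)
            ≡⟨ cong (+ 3 *_) (trans (SS-+ _ _) (cong₂ _+_ (SS-*ˡ (+ 2) _) (SS-const -1ℤ))) ⟨
          + 3 * SS (λ x y → + 2 * multiplicity ω (good x y) + -1ℤ)
            ≤⟨ *-monoˡ 3 (SS-mono (agreement ω)) ⟩
          + 3 * correlation (f ω) (exchange ω) g       ∎
          where
          open ℤ.≤-Reasoning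
          4-3 : ∀ n → n ≡ + 2 * (+ 2 * n) + + 3 * (n * -1ℤ)
          4-3 = solve-∀
          factor : ∀ h n → + 2 * (+ 3 * h) + + 3 * n ≡ + 3 * (+ 2 * h + n)
          factor = solve-∀

      -- Squaring N ≤ 3E gives 2^(4K) ≤ 9 E² ≤ 9 · 2^(2c) · 2^(3K), from which 2^(3K), called `N³`,
      -- cancels.
      inner-product-bound : 2 ℕ.^ K ℕ.≤ 9 ℕ.* (2 ℕ.^ c ℕ.* 2 ℕ.^ c)
      inner-product-bound with likely-point
      ... | ω , 2N≤3h = ℤ.drop‿+≤+ (begin
        2^ K                           ≤⟨ ℤ.*-cancelʳ-≤-pos (2^ K) (+ 9 * (2^ c * 2^ c)) (+ N³) {{pos}} cubed ⟩
        + 9 * (2^ c * 2^ c)            ≡⟨ cong (+ 9 *_) (ℤ.pos-* (2 ℕ.^ c) (2 ℕ.^ c)) ⟨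
        + 9 * + (2 ℕ.^ c ℕ.* 2 ℕ.^ c)  ≡⟨ ℤ.pos-* 9 (2 ℕ.^ c ℕ.* 2 ℕ.^ c) ⟨
        + (9 ℕ.* (2 ℕ.^ c ℕ.* 2 ℕ.^ c)) ∎)
        where
        open ℤ.≤-Reasoning
        N³ : ℕ
        N³ = 2 ℕ.^ K ℕ.* (2 ℕ.^ K ℕ.* 2 ℕ.^ K)
        N³≡ : + N³ ≡ 2^ K * (2^ K * 2^ K)
        N³≡ = trans (ℤ.pos-* (2 ℕ.^ K) _) (cong (2^ K *_) (ℤ.pos-* (2 ℕ.^ K) (2 ℕ.^ K)))
        pos : ℤ.Positive (+ N³)
        pos = ℤ.positive (ℤ.+<+ (ℕ.*-mono-≤ (ℕ.m^n>0 2 K) (ℕ.*-mono-≤ (ℕ.m^n>0 2 K) (ℕ.m^n>0 2 K))))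
        E : ℤ
        E = correlation (f ω) (exchange ω) g
        0≤N : 0ℤ ≤ N
        0≤N = ℤ.≤-trans (+≤+ ℕ.z≤n) (ℤ.≤-reflexive (ℤ.pos-* (2 ℕ.^ K) (2 ℕ.^ K)))
        sq-mono : ∀ {i j} → 0ℤ ≤ i → i ≤ j → sq i ≤ sq j
        sq-mono {i} {j} 0≤i i≤j = ℤ.≤-trans
          (ℤ.*-monoˡ-≤-nonNeg i {{ℤ.nonNegative 0≤i}} i≤j)
          (ℤ.*-monoʳ-≤-nonNeg j {{ℤ.nonNegative (ℤ.≤-trans 0≤i i≤j)}} i≤j)
        cubed : 2^ K * + N³ ≤ + 9 * (2^ c * 2^ c) * + N³
        cubed = begin
          2^ K * + N³                         ≡⟨ cong (2^ K *_) N³≡ ⟩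
          2^ K * (2^ K * (2^ K * 2^ K))       ≡⟨ fourth (2^ K) ⟩
          sq N                                ≤⟨ sq-mono 0≤N (advantage ω 2N≤3h) ⟩
          sq (+ 3 * E)                        ≡⟨ nine E ⟩
          + 9 * sq E                          ≤⟨ *-monoˡ 9 (correlation-bound (f ω) (exchange ω) g) ⟩
          + 9 * (2^ c * (2^ c * (2^ K * (2^ K * 2^ K)))) ≡⟨ cong (λ t → + 9 * (2^ c * (2^ c * t))) N³≡ ⟨
          + 9 * (2^ c * (2^ c * + N³))        ≡⟨ assoc (2^ c) (+ N³) ⟩
          + 9 * (2^ c * 2^ c) * + N³          ∎
          where
          fourth : ∀ k → k * (k * (k * k)) ≡ k * k * (k * k)
          fourth = solve-∀
          nine : ∀ e → + 3 * e * (+ 3 * e) ≡ + 9 * (e * e)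
          nine = solve-∀
          assoc : ∀ p q → + 9 * (p * (p * q)) ≡ + 9 * (p * p) * q
          assoc = solve-∀

open Discrepancy

module Reduction where

  open import Data.Nat using (_<_; _<?_; _≤_; _+_; _*_; _∸_; _^_; z≤n; s≤s)

  -- Encodings of fixed length and disjunctions.

  flatten : ∀ {a b} → (Fin a → Bits b) → Bits (a * b)
  flatten {zero}  f = []
  flatten {suc a} f = f zero ++ flatten (f ∘ suc)

  flatten-cong : ∀ {a b} {f g : Fin a → Bits b} → (∀ i → f i ≡ g i) → flatten f ≡ flatten g
  flatten-cong {zero}  f≗g = refl
  flatten-cong {suc a} f≗g = cong₂ _++_ (f≗g zero) (flatten-cong (f≗g ∘ suc))

  flatten-injective : ∀ {a b} (f g : Fin a → Bits b) → flatten f ≡ flatten g → ∀ i → f i ≡ g i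
  flatten-injective f g eq zero    = Vec.++-injectiveˡ (f zero) (g zero) eq
  flatten-injective f g eq (suc i) =
    flatten-injective (f ∘ suc) (g ∘ suc) (Vec.++-injectiveʳ (f zero) (g zero) eq) i

  -- Each of the B slots holds a presence bit and a data bit.
  encodeᵛ : ∀ B {m} → Vec Bool m → Bits (B * 2)
  encodeᵛ zero    v       = []
  encodeᵛ (suc B) []      = false ∷ false ∷ encodeᵛ B []
  encodeᵛ (suc B) (b ∷ v) = true ∷ b ∷ encodeᵛ B v

  encodeᵛ-injective : ∀ B {m m′} (v : Vec Bool m) (v′ : Vec Bool m′) → .(m ≤ B) → .(m′ ≤ B) →
                      encodeᵛ B v ≡ encodeᵛ B v′ → _≡_ {A = ∃ (Vec Bool)} (m , v) (m′ , v′)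
  encodeᵛ-injective B       []      []        _ _ _  = refl
  encodeᵛ-injective (suc B) []      (_ ∷ _)   _ _ ()
  encodeᵛ-injective (suc B) (_ ∷ _) []        _ _ ()
  encodeᵛ-injective (suc B) (b ∷ v) (b′ ∷ v′) p q eq
    with encodeᵛ-injective B v v′ (ℕ.s≤s⁻¹ p) (ℕ.s≤s⁻¹ q) (Vec.∷-injectiveʳ (Vec.∷-injectiveʳ eq))
       | Vec.∷-injectiveˡ (Vec.∷-injectiveʳ eq)
  ... | refl | refl = refl

  encode : ∀ {B} → Vec≤ Bool B → Bits (B * 2)
  encode {B} (v Vec≤., _) = encodeᵛ B v

  encode-injective : ∀ {B} (v v′ : Vec≤ Bool B) → encode v ≡ encode v′ → v ≡ v′
  encode-injective {B} (v Vec≤., p) (v′ Vec≤., p′) eq with encodeᵛ-injective B v v′ p p′ eq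
  ... | refl = refl

  some : ∀ {n} → (Fin n → Bool) → Bool
  some {zero}  f = false
  some {suc n} f = f zero ∨ some (f ∘ suc)

  some-cong : ∀ {n} {f g : Fin n → Bool} → (∀ i → f i ≡ g i) → some f ≡ some g
  some-cong {zero}  f≗g = refl
  some-cong {suc n} f≗g = cong₂ _∨_ (f≗g zero) (some-cong (f≗g ∘ suc))

  some-intro : ∀ {n} (f : Fin n → Bool) i → f i ≡ true → some f ≡ true
  some-intro f zero    fi rewrite fi = refl
  some-intro f (suc i) fi = trans (cong (f zero ∨_) (some-intro (f ∘ suc) i fi)) (Bool.∨-zeroʳ (f zero))

  some-elim : ∀ {n} (f : Fin n → Bool) → some f ≡ true → ∃ λ i → f i ≡ true
  some-elim {suc n} f eq with f zero in f0
  ... | true  = zero , f0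
  ... | false with some-elim (f ∘ suc) eq
  ...   | i , fi = suc i , fi

  ∧-true₂ : ∀ p {q} → p ∧ q ≡ true → q ≡ true
  ∧-true₂ true q≡true = q≡true

  linked⇒Link : ∀ {n} (G : Digraph n) u v → Digraph.linked G u v ≡ true → Digraph.Link G u v
  linked⇒Link G u v eq with lookup (Digraph.out G u) v in uv
  ... | true  = inj₁ (Vec.lookup⇒[]= v _ uv)
  ... | false = inj₂ (Vec.lookup⇒[]= u _ eq)

  -- The owner of x simulates the vertices v with τ + 1 + lo v < L at time τ,
  -- and the owner of y those with τ < hi v.  The feeds are the messages,
  -- given by sender and receiver, that a player cannot compute alone.
  record Cut {X Y : Set} {n} (I : X → Y → Instance n) : Set where
    open Instance
    open Digraph
    field
      L w         : ℕ
      lo hi       : Fin n → ℕ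
      lo≤hi       : ∀ v → lo v ≤ hi v
      view-left   : ∀ x y y′ v → suc (lo v) < L → view (I x y) v ≡ view (I x y′) v
      view-right  : ∀ x x′ y v → 0 < hi v → view (I x y) v ≡ view (I x′ y) v
      feedˡ feedʳ : ℕ → Fin w → Fin n × Fin n
      link-left   : ∀ x y τ u v → Link (graph (I x y)) u v → suc (suc τ) + lo v < L →
                    suc τ + lo u < L ⊎ ∃ λ i → feedˡ τ i ≡ (u , v)
      link-right  : ∀ x y τ u v → Link (graph (I x y)) u v → suc τ < hi v →
                    τ < hi u ⊎ ∃ λ i → feedʳ τ i ≡ (u , v)

  -- Simulation of a CONGEST protocol by two players.

  module Simulation {X Y : Set} {n B r : ℕ} {O : Set} {I : X → Y → Instance n} (cut : Cut I)
                    (A : Protocol n B r O) (ω : Coins n r) where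
    open Cut cut
    open Instance
    open Digraph
    open Protocol A

    private
      state : X → Y → ℕ → Fin n → State
      state x y = stateAfter A (I x y) ω

    -- A view lists outgoing and incoming arcs, so equal views mean equal neighbourhoods, and only
    -- messages over existing links have to be compared.
    step-cong : ∀ (J J′ : Instance n) τ v → view J v ≡ view J′ v →
      stateAfter A J ω τ v ≡ stateAfter A J′ ω τ v →
      (∀ u → Link (graph J) u v → send (stateAfter A J ω τ u) v ≡ send (stateAfter A J′ ω τ u) v) →
      stateAfter A J ω (suc τ) v ≡ stateAfter A J′ ω (suc τ) v
    step-cong J J′ τ v views states messages = cong₂ step states (Vec.tabulate-cong λ u →
      receive (linked (graph J) u v) (linked (graph J′) u v) (same-links u)
              (messages u ∘ linked⇒Link (graph J) u v))
      where
      in-view : ∀ (J : Instance n) u →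
        linked (graph J) u v ≡ lookup (View.inArcs (view J v)) u ∨ lookup (View.outArcs (view J v)) u
      in-view J u = cong (_∨ lookup (out (graph J) v) u) (sym (Vec.lookup∘tabulate _ u))
      same-links : ∀ u → linked (graph J) u v ≡ linked (graph J′) u v
      same-links u = trans (in-view J u) (trans
        (cong (λ V → lookup (View.inArcs V) u ∨ lookup (View.outArcs V) u) views) (sym (in-view J′ u)))
      receive : ∀ p q → p ≡ q → {m m′ : Vec≤ Bool B} → (p ≡ true → m ≡ m′) →
                (if p then just m else nothing) ≡ (if q then just m′ else nothing)
      receive true  _ refl m≡m′ = cong just (m≡m′ refl)
      receive false _ refl _    = refl

    private
      masked : {P : Set} → Dec P → ∀ {k} → Bits k → Bits k
      masked (yes _) m = m
      masked (no _)  m = Vec.replicate _ false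

      masked-cong : {P : Set} (P? : Dec P) → ∀ {k} {m m′ : Bits k} → (P → m ≡ m′) →
                    masked P? m ≡ masked P? m′
      masked-cong (yes p) m≡m′ = m≡m′ p
      masked-cong (no _)  _    = refl

      masked-yes : {P : Set} (P? : Dec P) → ∀ {k} {m m′ : Bits k} → P →
                   masked P? m ≡ masked P? m′ → m ≡ m′
      masked-yes (yes _) _ eq = eq
      masked-yes (no ¬p) p _  = contradiction p ¬p

      Left Right : ℕ → Fin n → Set
      Left  τ v = suc τ + lo v < L
      Right τ v = τ < hi v

      left? : ∀ τ v → Dec (Left τ v)
      left? τ v = suc τ + lo v <? L
      right? : ∀ τ v → Dec (Right τ v)
      right? τ v = τ <? hi v

      word : X → Y → ℕ → Fin n × Fin n → Bits (B * 2)
      word x y τ (u , v) = encode (send (state x y τ u) v)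

      -- What the owner of `x` is missing is supplied by the owner of `y`, and conversely. An entry
      -- whose sender the supplier does not simulate is blanked: the log keeps a fixed length, and
      -- every entry is known to its supplier.
      messageˡ messageʳ : X → Y → ℕ → Fin w → Bits (B * 2)
      messageˡ x y τ i = masked (right? τ (proj₁ (feedˡ τ i))) (word x y τ (feedˡ τ i))
      messageʳ x y τ i = masked (left? τ (proj₁ (feedʳ τ i))) (word x y τ (feedʳ τ i))

      log : ∀ T → (X → Y → ℕ → Fin w → Bits (B * 2)) → X → Y → Bits (T * (w * (B * 2)))
      log T m x y = flatten {T} λ τ → flatten (m x y (toℕ τ))

      log-injective : ∀ T m {x y x′ y′} → log T m x y ≡ log T m x′ y′ →
                      ∀ τ → τ < T → ∀ i → m x y τ i ≡ m x′ y′ τ i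
      log-injective T m {x} {y} {x′} {y′} eq τ τ<T =
        subst (λ τ → ∀ i → m x y τ i ≡ m x′ y′ τ i) (Fin.toℕ-fromℕ< τ<T)
          (flatten-injective _ _ (flatten-injective {T} _ _ eq (Fin.fromℕ< τ<T)))

    module Mixed (T : ℕ) (short : suc (T + T) < L) (x : X) (y : Y) (x′ : X) (y′ : Y)
      (sameˡ : log T messageˡ x y ≡ log T messageˡ x′ y′)
      (sameʳ : log T messageʳ x y ≡ log T messageʳ x′ y′) where

      private
        τ+τ<L : ∀ {τ} → τ < T → suc (τ + τ) < L
        τ+τ<L τ<T = ℕ.≤-<-trans (s≤s (ℕ.+-mono-≤ (ℕ.<⇒≤ τ<T) (ℕ.<⇒≤ τ<T))) short

        -- Outside both regions one would have `lo u` ≤ `hi u` ≤ τ, hence L ≤ 2τ + 1, which `short`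
        -- excludes.
        ¬left⇒right : ∀ {τ} u → τ < T → ¬ Left τ u → Right τ u
        ¬left⇒right {τ} u τ<T ¬left = ℕ.≰⇒> λ hi≤τ → ¬left
          (ℕ.≤-<-trans (s≤s (ℕ.+-monoʳ-≤ τ (ℕ.≤-trans (lo≤hi u) hi≤τ))) (τ+τ<L τ<T))

        ¬right⇒left : ∀ {τ} u → τ < T → ¬ Right τ u → Left τ u
        ¬right⇒left {τ} u τ<T ¬right with left? τ u
        ... | yes left = left
        ... | no ¬left = contradiction (¬left⇒right u τ<T ¬left) ¬right

      -- Cut and paste, by induction on the rounds. A sender outside the region of one player lies
      -- in that of the other, so it sends what it sends in the other player's run; the two runs
      -- have equal logs, so this is also what the first player expects.
      mixed : ∀ τ → τ ≤ T →
        (∀ v → Left τ v → state x y′ τ v ≡ state x y τ v) ×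
        (∀ v → Right τ v → state x y′ τ v ≡ state x′ y′ τ v)
      mixed zero    _    =
        (λ v left → cong (λ V → init V (lookup ω v)) (view-left x y′ y v left)) ,
        (λ v right → cong (λ V → init V (lookup ω v)) (view-right x x′ y′ v right))
      mixed (suc τ) τ<T with mixed τ (ℕ.<⇒≤ τ<T)
      ... | mixedˡ , mixedʳ = nextˡ , nextʳ
        where
        nextˡ : ∀ v → Left (suc τ) v → state x y′ (suc τ) v ≡ state x y (suc τ) v
        nextˡ v left = step-cong (I x y′) (I x y) τ v
          (view-left x y′ y v (ℕ.≤-<-trans (s≤s (ℕ.m≤n+m (lo v) (suc τ))) left))
          (mixedˡ v (ℕ.≤-<-trans (ℕ.n≤1+n _) left)) messages
          where
          messages : ∀ u → Link (graph (I x y′)) u v → send (state x y′ τ u) v ≡ send (state x y τ u) v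
          messages u link with left? τ u
          ... | yes leftᵤ = cong (λ s → send s v) (mixedˡ u leftᵤ)
          ... | no ¬left with link-left x y′ τ u v link left
          ...   | inj₁ leftᵤ = contradiction leftᵤ ¬left
          ...   | inj₂ (i , feed) = trans (cong (λ s → send s v) (mixedʳ u rightᵤ))
            (sym (encode-injective _ _ (masked-yes (right? τ u) rightᵤ
              (subst (λ e → masked (right? τ (proj₁ e)) (word x y τ e) ≡
                            masked (right? τ (proj₁ e)) (word x′ y′ τ e))
                     feed (log-injective T messageˡ sameˡ τ τ<T i)))))
            where rightᵤ = ¬left⇒right u τ<T ¬left
        nextʳ : ∀ v → Right (suc τ) v → state x y′ (suc τ) v ≡ state x′ y′ (suc τ) v
        nextʳ v right = step-cong (I x y′) (I x′ y′) τ v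
          (view-right x x′ y′ v (ℕ.≤-<-trans z≤n right))
          (mixedʳ v (ℕ.<-trans (ℕ.n<1+n τ) right)) messages
          where
          messages : ∀ u → Link (graph (I x y′)) u v → send (state x y′ τ u) v ≡ send (state x′ y′ τ u) v
          messages u link with right? τ u
          ... | yes rightᵤ = cong (λ s → send s v) (mixedʳ u rightᵤ)
          ... | no ¬right with link-right x y′ τ u v link right
          ...   | inj₁ rightᵤ = contradiction rightᵤ ¬right
          ...   | inj₂ (i , feed) = trans (cong (λ s → send s v) (mixedˡ u leftᵤ))
            (encode-injective _ _ (masked-yes (left? τ u) leftᵤ
              (subst (λ e → masked (left? τ (proj₁ e)) (word x y τ e) ≡
                            masked (left? τ (proj₁ e)) (word x′ y′ τ e))
                     feed (log-injective T messageʳ sameʳ τ τ<T i))))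
            where leftᵤ = ¬right⇒left u τ<T ¬right

      mixed-logˡ : log T messageˡ x y′ ≡ log T messageˡ x y
      mixed-logˡ = trans (flatten-cong {T} λ τ → flatten-cong λ i →
        masked-cong (right? (toℕ τ) (proj₁ (feedˡ (toℕ τ) i))) λ right →
          cong (λ s → encode (send s (proj₂ (feedˡ (toℕ τ) i))))
               (proj₂ (mixed (toℕ τ) (ℕ.<⇒≤ (Fin.toℕ<n τ))) _ right)) (sym sameˡ)

      mixed-logʳ : log T messageʳ x y′ ≡ log T messageʳ x y
      mixed-logʳ = flatten-cong {T} λ τ → flatten-cong λ i →
        masked-cong (left? (toℕ τ) (proj₁ (feedʳ (toℕ τ) i))) λ left →
          cong (λ s → encode (send s (proj₂ (feedʳ (toℕ τ) i))))
               (proj₁ (mixed (toℕ τ) (ℕ.<⇒≤ (Fin.toℕ<n τ))) _ left)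

    module _ (T : ℕ) (short : suc (T + T) < L) (raised : O → Bool) where

      private
        flag : X → Y → Fin n → Bool
        flag x y v = raised (outputAfter A (I x y) ω T v)

        -- An answer may appear at any vertex. At time T the two regions still cover the network, so
        -- one bit from each player tells whether a flag is raised anywhere.
        flagˡ flagʳ : X → Y → Bool
        flagˡ x y = some λ v → does (left? T v) ∧ flag x y v
        flagʳ x y = some λ v → does (right? T v) ∧ flag x y v

      transcriptLength : ℕ
      transcriptLength = 2 + (T * (w * (B * 2)) + T * (w * (B * 2)))

      transcript : X → Y → Bits transcriptLength
      transcript x y = flagˡ x y ∷ flagʳ x y ∷ (log T messageˡ x y ++ log T messageʳ x y)

      transcript-exchange : Exchange transcript
      transcript-exchange x y x′ y′ eq =
        cong₂ _∷_ (some-cong λ v → flag-cong (left? T v) (proj₁ (mixed T ℕ.≤-refl) v))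
       (cong₂ _∷_ (trans (some-cong λ v → flag-cong (right? T v) (proj₂ (mixed T ℕ.≤-refl) v))
                         (sym (Vec.∷-injectiveˡ (Vec.∷-injectiveʳ eq))))
       (cong₂ _++_ mixed-logˡ mixed-logʳ))
        where
        logs : log T messageˡ x y ++ log T messageʳ x y ≡ log T messageˡ x′ y′ ++ log T messageʳ x′ y′
        logs = Vec.∷-injectiveʳ (Vec.∷-injectiveʳ eq)
        open Mixed T short x y x′ y′
          (Vec.++-injectiveˡ (log T messageˡ x y) _ logs) (Vec.++-injectiveʳ (log T messageˡ x y) _ logs)
        flag-cong : {P : Set} (P? : Dec P) {s s′ : State} → (P → s ≡ s′) →
                    does P? ∧ raised (output s) ≡ does P? ∧ raised (output s′)
        flag-cong (yes p) s≡s′ = cong (raised ∘ output) (s≡s′ p)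
        flag-cong (no _)  _    = refl

      transcript-verdict : Bits transcriptLength → Bool
      transcript-verdict (p ∷ q ∷ _) = p ∨ q

      verdict-raised : ∀ x y v → flag x y v ≡ true → transcript-verdict (transcript x y) ≡ true
      verdict-raised x y v raisedᵥ with left? T v in isleft
      ... | yes _ = cong (_∨ flagʳ x y) (some-intro _ v
        (cong₂ _∧_ (cong does isleft) raisedᵥ))
      ... | no ¬left = trans (cong (flagˡ x y ∨_) (some-intro _ v
        (cong₂ _∧_ (dec-true (right? T v) right) raisedᵥ))) (Bool.∨-zeroʳ (flagˡ x y))
        where
        right : Right T v
        right = ℕ.≰⇒> λ hi≤T → ¬left
          (ℕ.≤-<-trans (s≤s (ℕ.+-monoʳ-≤ T (ℕ.≤-trans (lo≤hi v) hi≤T))) short)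

      raised-verdict : ∀ x y → transcript-verdict (transcript x y) ≡ true → ∃ λ v → flag x y v ≡ true
      raised-verdict x y eq with flagˡ x y in isleft
      ... | true with some-elim _ isleft
      ...   | v , both = v , ∧-true₂ (does (left? T v)) both
      raised-verdict x y eq | false with some-elim _ eq
      ...   | v , both = v , ∧-true₂ (does (right? T v)) both

  -- Outputs reveal whether a detour exists.

  isFin : Maybe Weight → Bool
  isFin (just (fin _)) = true
  isFin (just ∞)       = false
  isFin nothing        = false

  isFin-just : ∀ w → isFin w ≡ true → ∃ λ k → w ≡ just (fin k)
  isFin-just (just (fin k)) _ = k , refl

  Detects : ∀ {n} → Set → (Fin n → Bool) → Set
  Detects P flag = (P → ∃ λ v → flag v ≡ true) × (∀ v → flag v ≡ true → P)

  Says : Set → Weight → Set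
  Says P (fin _) = P
  Says P ∞       = ¬ P

  -- Both halves of `Computed` count: an existing announcement cannot be `∞` when `P` holds, and the
  -- correctness of all announcements excludes false alarms.
  Computed⇒Detects : ∀ {n P} {Good : Weight → Set} (r : Fin n → Report n) →
    (∀ w → Good w → Says P w) → Computed Good r → Detects P (isFin ∘ Report.weight ∘ r)
  Computed⇒Detects {P = P} {Good} r says (announced , good) = detected announced , sound
    where
    detected : (∃₂ λ v w → Report.weight (r v) ≡ just w) → P → _
    detected (v , fin k , vw) _ = v , cong isFin vw
    detected (v , ∞ , vw)     p = contradiction p (says ∞ (good v ∞ vw))
    sound : ∀ v → isFin (Report.weight (r v)) ≡ true → P
    sound v raised with isFin-just (Report.weight (r v)) raised
    ... | k , vk = says (fin k) (good v (fin k) vk)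

  module _ {n} {G : Digraph n} {u v : Fin n} (C : Path G u v → Set) where

    IsOpt⇒Says : ∀ w → IsOpt C w → Says (∃ C) w
    IsOpt⇒Says _ (attained p (Cp , _)) = p , Cp
    IsOpt⇒Says _ (none ¬C)             = λ (p , Cp) → ¬C p Cp

    -- `Within` relates `∞` to `∞` only, so an approximation still tells finite from infinite.
    Within⇒Says : ∀ {α} w → (∃ λ opt → IsOpt C opt × Within α opt w) → Says (∃ C) w
    Within⇒Says w (.(fin _) , isOpt , fin _ _) = IsOpt⇒Says _ isOpt
    Within⇒Says w (.∞       , isOpt , ∞)       = IsOpt⇒Says _ isOpt

  -- `raised` receives the ends of the single edge because the outputs for replacement paths are
  -- indexed by edges.
  record Revealing (Π : Problem) : Set where
    open Instance
    field
      raised  : ∀ {n} → Fin n → Fin n → Problem.Out Π n → Bool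
      reveals : ∀ {n} (I : Instance n) → edges (Pst I) ≡ (s I , t I) ∷ [] →
                ∀ o → Problem.Correct Π I o →
                Detects (∃ (Avoids I (s I , t I))) (raised (s I) (t I) ∘ o)

  Detects-map : ∀ {n P Q} {flag : Fin n → Bool} → (P → Q) → (Q → P) → Detects P flag → Detects Q flag
  Detects-map to from (detected , sound) = detected ∘ from , λ v → to ∘ sound v

  module _ {n} (I : Instance n) (single : edges (Instance.Pst I) ≡ (Instance.s I , Instance.t I) ∷ []) where
    open Instance I

    st∈Pst : (s , t) ∈ edges Pst
    st∈Pst = subst ((s , t) ∈_) (sym single) (here refl)

    AvoidsSome⇒Avoids : ∃ (AvoidsSome I) → ∃ (Avoids I (s , t))
    AvoidsSome⇒Avoids (p , e , e∈ , e∉) with subst (e ∈_) single e∈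
    ... | here refl = p , e∉

    Avoids⇒AvoidsSome : ∃ (Avoids I (s , t)) → ∃ (AvoidsSome I)
    Avoids⇒AvoidsSome (p , st∉) = p , _ , st∈Pst , st∉

  RPaths-revealing : Revealing RPaths
  RPaths-revealing = record
    { raised  = λ s t o → isFin (Report.weight (o (s , t)))
    ; reveals = λ I single o correct →
        Computed⇒Detects (λ v → o v _) (IsOpt⇒Says (Avoids I (Instance.s I , Instance.t I))) (proj₁ (correct _ (st∈Pst I single)))
    }

  2-SiSP-revealing : Revealing 2-SiSP
  2-SiSP-revealing = record
    { raised  = λ s t o → isFin (Report.weight o)
    ; reveals = λ I single o correct →
        Detects-map (AvoidsSome⇒Avoids I single) (Avoids⇒AvoidsSome I single)
          (Computed⇒Detects o (IsOpt⇒Says (AvoidsSome I)) (proj₁ correct))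
    }

  ApproxRPaths-revealing : ∀ α → Revealing (ApproxRPaths α)
  ApproxRPaths-revealing α = record
    { raised  = λ s t o → isFin (Report.weight (o (s , t)))
    ; reveals = λ I single o correct →
        Computed⇒Detects (λ v → o v _) (Within⇒Says (Avoids I (Instance.s I , Instance.t I))) (correct _ (st∈Pst I single))
    }

  Approx2-SiSP-revealing : ∀ α → Revealing (Approx2-SiSP α)
  Approx2-SiSP-revealing α = record
    { raised  = λ s t o → isFin (Report.weight o)
    ; reveals = λ I single o correct →
        Detects-map (AvoidsSome⇒Avoids I single) (Avoids⇒AvoidsSome I single)
          (Computed⇒Detects o (Within⇒Says (AvoidsSome I)) correct)
    }

  -- Trade-off between rounds and input bits.

  record HardFamily (n D K : ℕ) : Set where
    open Instance
    field
      I        : Bits K → Bits K → Instance n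
      cut      : Cut I
      class    : ∀ x y → SingleEdge D (I x y)
      s₀ t₀    : Fin n
      s≡       : ∀ x y → s (I x y) ≡ s₀
      t≡       : ∀ x y → t (I x y) ≡ t₀
      single   : ∀ x y → edges (Pst (I x y)) ≡ (s (I x y) , t (I x y)) ∷ []
      detour   : ∀ x y → dot x y ≡ true → ∃ (Avoids (I x y) (s (I x y) , t (I x y)))
      noDetour : ∀ x y → dot x y ≡ false → ¬ ∃ (Avoids (I x y) (s (I x y) , t (I x y)))
    open Cut cut public using (L; w)

  module _ {Π n D K} (revealing : Revealing Π) (F : HardFamily n D K) where
    open HardFamily F
    open Revealing revealing

    -- The transcript has c = 2 + 4TwB bits: two flags, and per round and direction w messages of 2B
    -- encoded bits. As 9 < 2^4, the discrepancy bound gives K < 4 + 2c.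
    short-run-impossible : ∀ {B r} T (A : Protocol n B r (Problem.Out Π n)) →
      SolvesWithin Π A T (SingleEdge D) → suc (T + T) < L →
      K < 8 + 8 * (T * (w * B))
    short-run-impossible {B} {r} T A solves short = ℕ.≰⇒> λ bits≤K →
      ℕ.<⇒≱ too-few (ℕ.≤-trans (ℕ.^-monoʳ-≤ 2 bits≤K) bound)
      where
      c : ℕ
      c = 2 + (T * (w * (B * 2)) + T * (w * (B * 2)))
      coins : List (Coins n r)
      coins = vecs (bits r) n
      length-coins : length coins ≡ (2 ^ r) ^ n
      length-coins = trans (length-vecs (bits r) n) (cong (_^ n) (length-vecs bools r))
      flag : Problem.Out Π n → Bool
      flag = raised s₀ t₀
      module S ω = Simulation cut A ω
      bound : 2 ^ K ≤ 9 * (2 ^ c * 2 ^ c)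
      bound = inner-product-bound (Vec.≡-dec _≟ᵇ_) {coins}
        (vecs-enumerates _≟ᵇ_ {bits r} (vecs-enumerates Bool._≟_ bools-enumerates r) n)
        (subst (0 <_) (sym length-coins) (ℕ.m^n>0 (2 ^ r) {{ℕ.m^n≢0 2 r}} n))
        (λ ω → S.transcript ω T short flag)
        (λ ω → S.transcript-exchange ω T short flag)
        -- The verdict reads only the two flags of a given transcript, so arbitrary coins can stand
        -- here.
        (S.transcript-verdict (Vec.replicate n (Vec.replicate r false)) T short flag)
        (λ x y → proj₁ (solves (I x y) (class x y)))
        (λ x y → proj₁ (proj₂ (solves (I x y) (class x y))))
        (λ x y → subst (λ l → 2 * l ≤ 3 * length (proj₁ (solves (I x y) (class x y)))) (sym length-coins)
                       (proj₂ (proj₂ (proj₂ (solves (I x y) (class x y))))))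
        (λ x y {ω} ω∈ → correct x y ω
          (All.lookup (proj₁ (proj₂ (proj₂ (solves (I x y) (class x y))))) ω∈))
        where
        correct : ∀ x y ω → Problem.Correct Π (I x y) (outputAfter A (I x y) ω T) →
                  S.transcript-verdict ω T short flag (S.transcript ω T short flag x y) ≡ dot x y
        correct x y ω right
          with subst (λ s → Detects _ (raised s _ ∘ outputAfter A (I x y) ω T)) (s≡ x y)
                 (subst (λ t → Detects _ (raised _ t ∘ outputAfter A (I x y) ω T)) (t≡ x y)
                   (reveals (I x y) (single x y) _ right))
             | dot x y in isdot
        ... | detected , sound | true with detected (detour x y isdot)
        ...   | v , raisedᵥ = S.verdict-raised ω T short flag x y v raisedᵥ
        correct x y ω right | detected , sound | false
          with S.transcript-verdict ω T short flag (S.transcript ω T short flag x y) in isverdict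
        ... | false = refl
        ... | true with S.raised-verdict ω T short flag x y isverdict
        ...   | v , raisedᵥ = contradiction (sound v raisedᵥ) (noDetour x y isdot)
      too-few : 9 * (2 ^ c * 2 ^ c) < 2 ^ (8 + 8 * (T * (w * B)))
      too-few = begin-strict
        9 * (2 ^ c * 2 ^ c)   <⟨ ℕ.*-monoˡ-< (2 ^ c * 2 ^ c) {{ℕ.m*n≢0 _ _ {{ℕ.m^n≢0 2 c}} {{ℕ.m^n≢0 2 c}}}} {9} {16} (ℕ.m≤m+n 10 6) ⟩
        2 ^ 4 * (2 ^ c * 2 ^ c) ≡⟨ cong (2 ^ 4 *_) (ℕ.^-distribˡ-+-* 2 c c) ⟨
        2 ^ 4 * 2 ^ (c + c)   ≡⟨ ℕ.^-distribˡ-+-* 2 4 (c + c) ⟨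
        2 ^ (4 + (c + c))       ≡⟨ cong (2 ^_) (count T w B) ⟩
        2 ^ (8 + 8 * (T * (w * B))) ∎
        where
        open ℕ.≤-Reasoning
        count : ∀ T w B → let c = 2 + (T * (w * (B * 2)) + T * (w * (B * 2))) in
                4 + (c + c) ≡ 8 + 8 * (T * (w * B))
        count T w B = lemma T w B
          where
          lemma : ∀ T w B → 4 + ((2 + (T * (w * (B * 2)) + T * (w * (B * 2)))) +
                   (2 + (T * (w * (B * 2)) + T * (w * (B * 2))))) ≡ 8 + 8 * (T * (w * B))
          lemma = ℕ-Solver.solve-∀

  -- Walks: bounded length, potentials, loop erasure.

  module _ {V : Set} {R : Rel V 0ℓ} where

    Reach : ℕ → Rel V 0ℓ
    Reach k u v = Σ (Star R u v) λ w → len w ≤ k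

    reach-refl : ∀ {u} → Reach 0 u u
    reach-refl = ε , z≤n

    reach-step : ∀ {k u v w} → R u v → Reach k v w → Reach (suc k) u w
    reach-step uv (w , len≤k) = uv ◅ w , s≤s len≤k

    reach-mono : ∀ {j k u v} → j ≤ k → Reach j u v → Reach k u v
    reach-mono j≤k (w , len≤j) = w , ℕ.≤-trans len≤j j≤k

    len-◅◅ : ∀ {u v z} (p : Star R u v) (q : Star R v z) → len (p ◅◅ q) ≡ len p + len q
    len-◅◅ ε       q = refl
    len-◅◅ (_ ◅ p) q = cong suc (len-◅◅ p q)

    reach-trans : ∀ {j k u v z} → Reach j u v → Reach k v z → Reach (j + k) u z
    reach-trans (p , p≤j) (q , q≤k) =
      p ◅◅ q , ℕ.≤-trans (ℕ.≤-reflexive (len-◅◅ p q)) (ℕ.+-mono-≤ p≤j q≤k)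

    reach-sym : Symmetric R → ∀ {k u v} → Reach k u v → Reach k v u
    reach-sym R-sym (p , p≤k) = reach-mono p≤k (back p)
      where
      back : ∀ {u v} (p : Star R u v) → Reach (len p) v u
      back ε        = reach-refl
      back (uv ◅ p) = reach-mono (ℕ.≤-reflexive (ℕ.+-comm (len p) 1))
                        (reach-trans (back p) (R-sym uv ◅ ε , s≤s z≤n))

    -- The source of the lower bound on the diameter: a function that grows by at most one per link
    -- bounds distances from below.
    potential : (φ : V → ℕ) → (∀ {u v} → R u v → φ v ≤ suc (φ u)) →
                ∀ {u v} (p : Star R u v) → φ v ≤ len p + φ u
    potential φ smooth ε        = ℕ.≤-refl
    potential φ smooth {u} {v} (_◅_ {j = z} uz p) = begin
      φ v                ≤⟨ potential φ smooth p ⟩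
      len p + φ z        ≤⟨ ℕ.+-monoʳ-≤ (len p) (smooth uz) ⟩
      len p + suc (φ u)  ≡⟨ ℕ.+-suc (len p) (φ u) ⟩
      suc (len p + φ u)  ∎
      where open ℕ.≤-Reasoning

    arcs⇒R : ∀ {u v} (p : Star R u v) {a b} → (a , b) ∈ arcs p → R a b
    arcs⇒R (uv ◅ p) (here refl) = uv
    arcs⇒R (uv ◅ p) (there ab∈) = arcs⇒R p ab∈

    SimpleWalk : Rel V 0ℓ
    SimpleWalk u v = Σ (Star R u v) λ p → Unique (vertices p)

    from-vertex : ∀ {u v z} (p : Star R u v) → Unique (vertices p) → z ∈ vertices p → SimpleWalk z v
    from-vertex ε        unique       (here refl) = ε , unique
    from-vertex (uv ◅ p) unique       (here refl) = uv ◅ p , unique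
    from-vertex (uv ◅ p) (_ ∷ unique) (there z∈)  = from-vertex p unique z∈

    erase-loops : DecidableEquality V → ∀ {u v} → Star R u v → SimpleWalk u v
    erase-loops _≟_ ε = ε , [] ∷ []
    erase-loops _≟_ {u} (uv ◅ p) with erase-loops _≟_ p
    ... | q , unique with member? _≟_ u (vertices q)
    ...   | yes u∈ = from-vertex q unique u∈
    ...   | no u∉  = uv ◅ q , All.¬Any⇒All¬ (vertices q) u∉ ∷ unique

  reach-map : ∀ {V W : Set} {R : Rel V 0ℓ} {S : Rel W 0ℓ} (f : V → W) → (∀ {u v} → R u v → S (f u) (f v)) →
              ∀ {k u v} → Reach {R = R} k u v → Reach {R = S} k (f u) (f v)
  reach-map {R = R} {S} f g (p , p≤k) = reach-mono p≤k (go p)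
    where
    go : ∀ {u v} (p : Star R u v) → Reach {R = S} (len p) (f u) (f v)
    go ε       = reach-refl
    go (r ◅ p) = reach-step (g r) (go p)

  module _ {V : Set} {R S : Rel V 0ℓ} (f : ∀ {u v} → R u v → S u v) where

    vertices-gmap : ∀ {u v} (p : Star R u v) → vertices (gmap id f p) ≡ vertices p
    vertices-gmap ε       = refl
    vertices-gmap (_ ◅ p) = cong (_ ∷_) (vertices-gmap p)

    arcs-gmap : ∀ {u v} (p : Star R u v) → arcs (gmap id f p) ≡ arcs p
    arcs-gmap ε       = refl
    arcs-gmap (_ ◅ p) = cong (_ ∷_) (arcs-gmap p)

  -- Partial inner products, spines and tracks.

  prefix : ∀ {K} → Bool → Bits K → Bits K → Fin (suc K) → Bool
  prefix acc x       y       zero    = acc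
  prefix acc (a ∷ x) (b ∷ y) (suc i) = prefix (acc xor (a ∧ b)) x y i

  prefix-suc : ∀ {K} acc (x y : Bits K) i →
               prefix acc x y (suc i) ≡ prefix acc x y (inject₁ i) xor (lookup x i ∧ lookup y i)
  prefix-suc acc (a ∷ x) (b ∷ y) zero    = refl
  prefix-suc acc (a ∷ x) (b ∷ y) (suc i) = prefix-suc (acc xor (a ∧ b)) x y i

  prefix-last : ∀ {K} acc (x y : Bits K) → prefix acc x y (fromℕ K) ≡ acc xor dot x y
  prefix-last acc []      []      = sym (Bool.xor-identityʳ acc)
  prefix-last acc (a ∷ x) (b ∷ y) =
    trans (prefix-last (acc xor (a ∧ b)) x y) (Bool.xor-assoc acc (a ∧ b) (dot x y))

  -- A rooted tree over L columns.  The node v is associated with the columns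
  -- from lo v to hi v; cross lists the nodes other than the root for which a
  -- threshold separates v from its parent.
  record Spine (L : ℕ) : Set₁ where
    field
      Node         : Set
      size         : ℕ
      code         : Node ↔ Fin size
      root         : Node
      parent       : Node → Maybe Node
      depth        : Node → ℕ
      depth-root   : depth root ≡ 0
      depth-parent : ∀ {v p} → parent v ≡ just p → depth v ≡ suc (depth p)
      climb        : ∀ v → v ≡ root ⊎ ∃ λ p → parent v ≡ just p
      leaf         : ℕ → Node
      leaf-smooth  : ∀ c → suc c < L → depth (leaf c) ≤ suc (depth (leaf (suc c))) ×
                                       depth (leaf (suc c)) ≤ suc (depth (leaf c))
      height       : ℕ
      depth<height : ∀ v → depth v < height
      deepest      : ∃ λ c → c < L × suc (depth (leaf c)) ≡ height
      lo hi        : Node → ℕ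
      lo≤hi        : ∀ v → lo v ≤ hi v
      lo-leaf      : ∀ c → c < L → lo (leaf c) ≡ c
      hi-leaf      : ∀ c → c < L → hi (leaf c) ≡ c
      width        : ℕ
      cross        : ℕ → Fin width → Node
      up-lo        : ∀ {v p} → parent v ≡ just p → lo p ≤ suc (lo v)
      up-hi        : ∀ {v p} → parent v ≡ just p → hi v ≤ suc (hi p)
      down-lo      : ∀ {v p} → parent v ≡ just p → ∀ θ → suc (lo p) < θ → θ ≤ lo v → ∃ λ i → cross θ i ≡ v
      down-hi      : ∀ {v p} → parent v ≡ just p → ∀ θ → hi v < θ → θ < hi p → ∃ λ i → cross θ i ≡ v

  -- A forward track must bring the bit of `x` to the last column, where `y` can be read, and so
  -- stores it next to the partial inner product; the way back needs only the latter.
  Forward Backward Track : ℕ → Set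
  Forward K  = Fin K × (Bool × Bool)
  Backward K = Fin (suc K) × Bool
  Track K    = Forward K ⊎ Backward K

  -- The hard graphs over a spine.

  module Family {L′ : ℕ} (S : Spine (suc L′)) (K m′ q : ℕ) (H≤m : Spine.height S ≤ suc m′) where
    open Spine S

    m : ℕ
    m = suc m′

    -- The tail is a path of m vertices hanging from the root and raises the diameter to m + height;
    -- the q pads hang singly from the root and fill up the number of vertices.
    Hub : Set
    Hub = Node ⊎ (Fin m ⊎ Fin q)

    Vertex : Set
    Vertex = (Track K × Fin (suc L′)) ⊎ Hub

    pattern fwd f c = inj₁ (inj₁ f , c)
    pattern ret g c = inj₁ (inj₂ g , c)
    pattern col f c = inj₁ (f , c)
    pattern hub v   = inj₂ v
    pattern spine v = inj₁ v
    pattern tail i  = inj₂ (inj₁ i)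
    pattern pad j   = inj₂ (inj₂ j)

    hubParent : Hub → Maybe Hub
    hubParent (spine v)      = Maybe.map inj₁ (parent v)
    hubParent (tail zero)    = just (spine root)
    hubParent (tail (suc i)) = just (tail (inject₁ i))
    hubParent (pad j)        = just (spine root)

    -- Tail and pads inherit the interval of the root, so none of their links needs a feed.
    low high depthᵛ : Vertex → ℕ
    low (col _ c)       = toℕ c
    low (hub (spine v)) = lo v
    low (hub (inj₂ _))  = lo root
    high (col _ c)       = toℕ c
    high (hub (spine v)) = hi v
    high (hub (inj₂ _))  = hi root
    depthᵛ (col _ c)       = suc (depth (leaf (toℕ c)))
    depthᵛ (hub (spine v)) = depth v
    depthᵛ (hub (tail i))  = suc (toℕ i)
    depthᵛ (hub (pad j))   = 1

    low≤high : ∀ v → low v ≤ high v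
    low≤high (col _ c)       = ℕ.≤-refl
    low≤high (hub (spine v)) = lo≤hi v
    low≤high (hub (inj₂ _))  = lo≤hi root

    start end : Vertex
    start = ret (zero , false) zero
    end   = ret (fromℕ K , true) zero

    -- A walk from start carries the partial inner product in its track: it
    -- reads x on the first column and y on the last one.
    Base : Bits K → Bits K → Rel Vertex 0ℓ
    Base x y (fwd f c) (fwd f′ c′)               = f ≡ f′ × toℕ c′ ≡ suc (toℕ c)
    Base x y (fwd (i , b , a) c) (ret g c′)      = g ≡ (suc i , b xor (a ∧ lookup y i)) × (c′ ≡ c × toℕ c ≡ L′)
    Base x y (ret g c) (fwd (i , b , a) c′)      = (g ≡ (inject₁ i , b) × a ≡ lookup x i) × (c′ ≡ c × toℕ c ≡ 0)
    Base x y (ret g c) (ret g′ c′)               = g ≡ g′ × toℕ c ≡ suc (toℕ c′)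
    Base x y (col _ _) (hub _)                   = ⊥
    Base x y (hub v) (col _ c)                   = spine (leaf (toℕ c)) ≡ v
    Base x y (hub p) (hub v)                     = hubParent v ≡ just p

    Arrow : Bits K → Bits K → Rel Vertex 0ℓ
    Arrow x y u v = Base x y u v ⊎ (u ≡ start × v ≡ end)

    start≢end : start ≢ end
    start≢end ()

    ¬Base-start-end : ∀ x y → ¬ Base x y start end
    ¬Base-start-end x y (() , _)

    depth-hubParent : ∀ v {p} → hubParent v ≡ just p → depthᵛ (hub v) ≡ suc (depthᵛ (hub p))
    depth-hubParent (spine v) eq with parent v in isparent
    depth-hubParent (spine v) refl | just p = depth-parent isparent
    depth-hubParent (tail zero)    refl = cong suc (sym depth-root)
    depth-hubParent (tail (suc i)) refl = cong (λ k → ℕ.suc (ℕ.suc k)) (sym (Fin.toℕ-inject₁ i))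
    depth-hubParent (pad j)        refl = cong suc (sym depth-root)

    Arrow-irrefl : ∀ x y v → ¬ Arrow x y v v
    Arrow-irrefl x y (fwd f c) (inj₁ (_ , eq)) = ℕ.m≢1+m+n (toℕ c) (trans eq (cong suc (sym (ℕ.+-identityʳ _))))
    Arrow-irrefl x y (ret g c) (inj₁ (_ , eq)) = ℕ.m≢1+m+n (toℕ c) (trans eq (cong suc (sym (ℕ.+-identityʳ _))))
    Arrow-irrefl x y (hub v)   (inj₁ eq)       =
      ℕ.m≢1+m+n _ (trans (depth-hubParent v eq) (cong suc (sym (ℕ.+-identityʳ _))))
    Arrow-irrefl x y v         (inj₂ (s , t))  = start≢end (trans (sym s) t)

    Near : ℕ → ℕ → Set
    Near j k = j ≤ suc k × k ≤ suc j

    near-refl : ∀ {j k} → j ≡ k → Near j k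
    near-refl refl = ℕ.n≤1+n _ , ℕ.n≤1+n _

    near-suc : ∀ {j k} → k ≡ suc j → Near j k
    near-suc refl = ℕ.m≤n⇒m≤1+n (ℕ.n≤1+n _) , ℕ.≤-refl

    near-sym : ∀ {j k} → Near j k → Near k j
    near-sym (p , q) = q , p

    -- The regions shrink by one column per round, so a link whose ends differ by at most one column
    -- always comes from inside the previous region. What remains are links within the spine.
    Arrow-near : ∀ x y u v → Arrow x y u v → (Near (low u) (low v) × Near (high u) (high v)) ⊎
      ∃₂ λ p c → u ≡ hub (spine p) × v ≡ hub (spine c) × parent c ≡ just p
    Arrow-near x y (fwd f c) (fwd f′ c′) (inj₁ (_ , eq)) = inj₁ (near-suc eq , near-suc eq)
    Arrow-near x y (fwd _ c) (ret g c′)  (inj₁ (_ , refl , _)) = inj₁ (near-refl refl , near-refl refl)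
    Arrow-near x y (ret g c) (fwd _ c′)  (inj₁ (_ , refl , _)) = inj₁ (near-refl refl , near-refl refl)
    Arrow-near x y (ret g c) (ret g′ c′) (inj₁ (_ , eq)) = inj₁ (near-sym (near-suc eq) , near-sym (near-suc eq))
    Arrow-near x y (hub _)   (col _ c)   (inj₁ refl) =
      inj₁ (near-refl (lo-leaf (toℕ c) (Fin.toℕ<n c)) , near-refl (hi-leaf (toℕ c) (Fin.toℕ<n c)))
    Arrow-near x y (hub p) (hub (spine v)) (inj₁ eq) with parent v in isparent
    Arrow-near x y (hub p) (hub (spine v)) (inj₁ refl) | just u = inj₂ (_ , _ , refl , refl , isparent)
    Arrow-near x y (hub p) (hub (tail zero)) (inj₁ refl) = inj₁ (near-refl refl , near-refl refl)
    Arrow-near x y (hub p) (hub (tail (suc i))) (inj₁ refl) = inj₁ (near-refl refl , near-refl refl)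
    Arrow-near x y (hub p) (hub (pad j)) (inj₁ refl) = inj₁ (near-refl refl , near-refl refl)
    Arrow-near x y _ _ (inj₂ (refl , refl)) = inj₁ (near-refl refl , near-refl refl)

    -- `y` affects only arcs inside the last column, which the region of the owner of `x` never
    -- contains.
    Base-left : ∀ x y y′ u v → suc (low u) < suc L′ ⊎ suc (low v) < suc L′ → Base x y u v → Base x y′ u v
    Base-left x y y′ (fwd f c) (fwd f′ c′) _ b = b
    Base-left x y y′ (fwd f c) (ret g c′) (inj₁ lt) (_ , refl , eq) = contradiction (cong suc eq) (ℕ.<⇒≢ lt)
    Base-left x y y′ (fwd f c) (ret g c′) (inj₂ lt) (_ , refl , eq) = contradiction (cong suc eq) (ℕ.<⇒≢ lt)
    Base-left x y y′ (ret g c) (fwd f c′) _ b = b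
    Base-left x y y′ (ret g c) (ret g′ c′) _ b = b
    Base-left x y y′ (hub _) (col _ _) _ b = b
    Base-left x y y′ (hub _) (hub _) _ b = b

    Base-right : ∀ x x′ y u v → 0 < high u ⊎ 0 < high v → Base x y u v → Base x′ y u v
    Base-right x x′ y (fwd f c) (fwd f′ c′) _ b = b
    Base-right x x′ y (ret g c) (fwd f c′) (inj₁ lt) (_ , refl , eq) = contradiction (sym eq) (ℕ.<⇒≢ lt)
    Base-right x x′ y (ret g c) (fwd f c′) (inj₂ lt) (_ , refl , eq) = contradiction (sym eq) (ℕ.<⇒≢ lt)
    Base-right x x′ y (fwd f c) (ret g c′) _ b = b
    Base-right x x′ y (ret g c) (ret g′ c′) _ b = b
    Base-right x x′ y (hub _) (col _ _) _ b = b
    Base-right x x′ y (hub _) (hub _) _ b = b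

    -- A potential that vanishes at the free end of the tail, is m at the root and increases away
    -- from it up to m + height.
    level : Vertex → ℕ
    level (hub (tail i)) = m ∸ suc (toℕ i)
    level v              = m + depthᵛ v

    near-+ : ∀ {j k} → Near j k → Near (m + j) (m + k)
    near-+ {j} {k} (p , q) = ℕ.≤-trans (ℕ.+-monoʳ-≤ m p) (ℕ.≤-reflexive (ℕ.+-suc m k)) ,
                             ℕ.≤-trans (ℕ.+-monoʳ-≤ m q) (ℕ.≤-reflexive (ℕ.+-suc m j))

    near-columns : ∀ (c c′ : Fin (suc L′)) → toℕ c′ ≡ suc (toℕ c) →
                   Near (suc (depth (leaf (toℕ c)))) (suc (depth (leaf (toℕ c′))))
    near-columns c c′ eq rewrite eq with leaf-smooth (toℕ c) (subst (_< suc L′) eq (Fin.toℕ<n c′))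
    ... | p , q = s≤s p , s≤s q

    level-near : ∀ x y u v → Arrow x y u v → Near (level u) (level v)
    level-near x y (fwd f c) (fwd f′ c′) (inj₁ (_ , eq)) = near-+ (near-columns c c′ eq)
    level-near x y (fwd _ c) (ret g c′)  (inj₁ (_ , refl , _)) = near-refl refl
    level-near x y (ret g c) (fwd _ c′)  (inj₁ (_ , refl , _)) = near-refl refl
    level-near x y (ret g c) (ret g′ c′) (inj₁ (_ , eq)) = near-sym (near-+ (near-columns c′ c eq))
    level-near x y (hub _)   (col _ c)   (inj₁ refl) = near-+ (near-suc refl)
    level-near x y (hub p) (hub (spine v)) (inj₁ eq) with parent v in isparent
    level-near x y (hub p) (hub (spine v)) (inj₁ refl) | just u = near-+ (near-suc (depth-parent isparent))
    level-near x y (hub p) (hub (tail zero)) (inj₁ refl) rewrite depth-root | ℕ.+-identityʳ m′ =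
      near-sym (near-suc refl)
    level-near x y (hub p) (hub (tail (suc i))) (inj₁ refl) rewrite Fin.toℕ-inject₁ i =
      near-sym (near-suc (ℕ.+-∸-assoc 1 (Fin.toℕ<n i)))
    level-near x y (hub p) (hub (pad j)) (inj₁ refl) = near-+ (near-suc (cong suc (sym depth-root)))
    level-near x y _ _ (inj₂ (refl , refl)) = near-refl refl

  does⇒ : ∀ {P : Set} (P? : Dec P) → does P? ≡ true → P
  does⇒ (yes p) _ = p

  -- Diameter, detours and cuts of the hard instances.

  module Instances {L′ : ℕ} (S : Spine (suc L′)) (K m′ q : ℕ) (H≤m : Spine.height S ≤ suc m′)
                   {n : ℕ} (codeᵛ : Family.Vertex S K m′ q H≤m ↔ Fin n) where
    open Spine S
    open Family S K m′ q H≤m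
    open Digraph using (Arc; Link; out; inn)

    private
      enc : Vertex → Fin n
      enc = Inverse.to codeᵛ
      dec : Fin n → Vertex
      dec = Inverse.from codeᵛ
      dec-enc : ∀ v → dec (enc v) ≡ v
      dec-enc v = Inverse.inverseʳ codeᵛ refl
      enc-dec : ∀ i → enc (dec i) ≡ i
      enc-dec i = Inverse.inverseˡ codeᵛ refl
      enc-injective : ∀ {u v} → enc u ≡ enc v → u ≡ v
      enc-injective {u} {v} eq = trans (sym (dec-enc u)) (trans (cong dec eq) (dec-enc v))

      _≟ᵛ_ : DecidableEquality Vertex
      u ≟ᵛ v = map′ enc-injective (cong enc) (enc u Fin.≟ enc v)

      _≟ʰ_ : DecidableEquality Hub
      u ≟ʰ v = map′ Sum.inj₂-injective (cong inj₂) (inj₂ u ≟ᵛ inj₂ v)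

      _≟ᶠ_ : DecidableEquality (Forward K)
      _≟ᶠ_ = Product.≡-dec Fin._≟_ (Product.≡-dec Bool._≟_ Bool._≟_)

      _≟ʳ_ : DecidableEquality (Backward K)
      _≟ʳ_ = Product.≡-dec Fin._≟_ Bool._≟_

    base? : ∀ x y u v → Dec (Base x y u v)
    base? x y (fwd f c) (fwd f′ c′) = (f ≟ᶠ f′) ×-dec (toℕ c′ ℕ.≟ suc (toℕ c))
    base? x y (fwd (i , b , a) c) (ret g c′) =
      (g ≟ʳ (suc i , b xor (a ∧ lookup y i))) ×-dec ((c′ Fin.≟ c) ×-dec (toℕ c ℕ.≟ L′))
    base? x y (ret g c) (fwd (i , b , a) c′) =
      ((g ≟ʳ (inject₁ i , b)) ×-dec (a Bool.≟ lookup x i)) ×-dec ((c′ Fin.≟ c) ×-dec (toℕ c ℕ.≟ 0))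
    base? x y (ret g c) (ret g′ c′) = (g ≟ʳ g′) ×-dec (toℕ c ℕ.≟ suc (toℕ c′))
    base? x y (fwd _ _) (hub _) = no λ ()
    base? x y (ret _ _) (hub _) = no λ ()
    base? x y (hub v) (col _ c) = spine (leaf (toℕ c)) ≟ʰ v
    base? x y (hub p) (hub v) = Maybe.≡-dec _≟ʰ_ (hubParent v) (just p)

    arrow? : ∀ x y u v → Dec (Arrow x y u v)
    arrow? x y u v = base? x y u v ⊎-dec ((u ≟ᵛ start) ×-dec (v ≟ᵛ end))

    digraph : Bits K → Bits K → Digraph n
    digraph x y = record
      { out      = λ u → tabulate (row u)
      ; loopless = λ v v∈ → Arrow-irrefl x y (dec v)
          (does⇒ (arrow? x y (dec v) (dec v)) (trans (sym (Vec.lookup∘tabulate (row v) v)) (Vec.[]=⇒lookup v∈)))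
      }
      where
      row : Fin n → Fin n → Bool
      row u v = does (arrow? x y (dec u) (dec v))

    Arc⇒Arrow : ∀ {x y u v} → Arc (digraph x y) u v → Arrow x y (dec u) (dec v)
    Arc⇒Arrow {x} {y} {u} {v} uv = does⇒ (arrow? x y (dec u) (dec v))
      (trans (sym (Vec.lookup∘tabulate (λ v → does (arrow? x y (dec u) (dec v))) v)) (Vec.[]=⇒lookup uv))

    Arrow⇒Arc : ∀ {x y u v} → Arrow x y (dec u) (dec v) → Arc (digraph x y) u v
    Arrow⇒Arc {x} {y} {u} {v} arrow = Vec.lookup⇒[]= v _
      (trans (Vec.lookup∘tabulate (λ v → does (arrow? x y (dec u) (dec v))) v)
             (dec-true (arrow? x y (dec u) (dec v)) arrow))

    ArrowLink : Bits K → Bits K → Rel Vertex 0ℓ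
    ArrowLink x y u v = Arrow x y u v ⊎ Arrow x y v u

    module _ (x y : Bits K) where

      private
        Reachᵛ : ℕ → Rel Vertex 0ℓ
        Reachᵛ = Reach {R = ArrowLink x y}

        rootᵛ : Vertex
        rootᵛ = hub (spine root)

      to-parent : ∀ {v p k z} → hubParent v ≡ just p → Reachᵛ k (hub p) z → Reachᵛ (suc k) (hub v) z
      to-parent eq = reach-step (inj₂ (inj₁ eq))

      spine-to-root : ∀ k v → depth v ≤ k → Reachᵛ k (hub (spine v)) rootᵛ
      spine-to-root k v v≤k with climb v
      spine-to-root k       v v≤k | inj₁ refl     = reach-mono z≤n reach-refl
      spine-to-root zero    v v≤k | inj₂ (p , eq) = contradiction (trans (sym (depth-parent eq)) (ℕ.n≤0⇒n≡0 v≤k)) λ ()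
      spine-to-root (suc k) v v≤k | inj₂ (p , eq) = to-parent (cong (Maybe.map inj₁) eq)
        (spine-to-root k p (ℕ.s≤s⁻¹ (subst (_≤ suc k) (depth-parent eq) v≤k)))

      tail-to-tail : ∀ k i j → toℕ j ≡ k + toℕ i → Reachᵛ k (hub (tail j)) (hub (tail i))
      tail-to-tail zero    i j       eq = subst (λ j → Reachᵛ 0 (hub (tail j)) (hub (tail i)))
                                            (sym (Fin.toℕ-injective eq)) reach-refl
      tail-to-tail (suc k) i (suc j) eq = to-parent refl
        (tail-to-tail k i (inject₁ j) (trans (Fin.toℕ-inject₁ j) (ℕ.suc-injective eq)))

      to-root : ∀ v → Reachᵛ (depthᵛ v) v rootᵛ
      to-root (col f c)       = reach-step (inj₂ (inj₁ refl)) (spine-to-root _ _ ℕ.≤-refl)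
      to-root (hub (spine v)) = spine-to-root _ _ ℕ.≤-refl
      to-root (hub (pad j))   = to-parent refl reach-refl
      to-root (hub (tail i))  = reach-mono (ℕ.≤-reflexive (ℕ.+-comm (toℕ i) 1))
        (reach-trans (tail-to-tail (toℕ i) zero i (sym (ℕ.+-identityʳ _))) (to-parent refl reach-refl))

      tail-or-shallow : ∀ v → (∃ λ i → v ≡ hub (tail i)) ⊎ depthᵛ v ≤ height
      tail-or-shallow (col f c)       = inj₂ (depth<height _)
      tail-or-shallow (hub (spine v)) = inj₂ (ℕ.<⇒≤ (depth<height v))
      tail-or-shallow (hub (tail i))  = inj₁ (i , refl)
      tail-or-shallow (hub (pad j))   = inj₂ (ℕ.≤-trans (s≤s z≤n) (depth<height root))

      via-root : ∀ u v → Reachᵛ (depthᵛ u + depthᵛ v) u v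
      via-root u v = reach-trans (to-root u) (reach-sym Sum.swap (to-root v))

      -- The route through the root is short enough unless both ends lie on the tail, where it could
      -- have length 2m; these are joined along the tail. For two vertices off the tail this uses
      -- height ≤ m.
      distance : ∀ u v → Reachᵛ (m + height) u v
      distance u v with tail-or-shallow u | tail-or-shallow v
      ... | inj₂ u≤ | inj₂ v≤ = reach-mono (ℕ.+-mono-≤ (ℕ.≤-trans u≤ H≤m) v≤) (via-root u v)
      ... | inj₁ (i , refl) | inj₂ v≤ = reach-mono (ℕ.+-mono-≤ (Fin.toℕ<n i) v≤) (via-root u v)
      ... | inj₂ u≤ | inj₁ (j , refl) = reach-mono
        (ℕ.≤-trans (ℕ.+-mono-≤ u≤ (Fin.toℕ<n j)) (ℕ.≤-reflexive (ℕ.+-comm height m))) (via-root u v)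
      ... | inj₁ (i , refl) | inj₁ (j , refl) = reach-mono (ℕ.m≤m+n m height) (tails (ℕ.≤-total (toℕ i) (toℕ j)))
        where
        along : ∀ i j → toℕ i ≤ toℕ j → Reachᵛ m (hub (tail j)) (hub (tail i))
        along i j i≤j = reach-mono (ℕ.≤-trans (ℕ.m∸n≤m (toℕ j) (toℕ i)) (ℕ.<⇒≤ (Fin.toℕ<n j)))
          (tail-to-tail (toℕ j ∸ toℕ i) i j (sym (ℕ.m∸n+n≡m i≤j)))
        tails : toℕ i ≤ toℕ j ⊎ toℕ j ≤ toℕ i → Reachᵛ m (hub (tail i)) (hub (tail j))
        tails (inj₁ i≤j) = reach-sym Sum.swap (along i j i≤j)
        tails (inj₂ j≤i) = along j i j≤i

      diameter : UndirectedDiameter (digraph x y) (m + height)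
      diameter = upper , enc (hub (tail (fromℕ m′))) , enc far , lower
        where
        G : Digraph n
        G = digraph x y
        link : ∀ {u v} → ArrowLink x y u v → Link G (enc u) (enc v)
        link {u} {v} = Sum.map
          (λ a → Arrow⇒Arc (subst₂ (Arrow x y) (sym (dec-enc u)) (sym (dec-enc v)) a))
          (λ a → Arrow⇒Arc (subst₂ (Arrow x y) (sym (dec-enc v)) (sym (dec-enc u)) a))
        upper : ∀ u v → Σ (Star (Link G) u v) λ w → len w ≤ m + height
        upper u v = subst₂ (Reach (m + height)) (enc-dec u) (enc-dec v)
          (reach-map enc link (distance (dec u) (dec v)))
        far : Vertex
        far = ret (zero , false) (fromℕ< (proj₁ (proj₂ deepest)))
        level-far : level (dec (enc far)) ≡ m + height
        level-far rewrite dec-enc far | Fin.toℕ-fromℕ< (proj₁ (proj₂ deepest)) = cong (m +_) (proj₂ (proj₂ deepest))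
        level-tail : level (dec (enc (hub (tail (fromℕ m′))))) ≡ 0
        level-tail rewrite dec-enc (hub (tail (fromℕ m′))) | Fin.toℕ-fromℕ m′ = ℕ.n∸n≡0 m′
        smooth : ∀ {u v} → Link G u v → level (dec v) ≤ suc (level (dec u))
        smooth (inj₁ uv) = proj₂ (level-near x y _ _ (Arc⇒Arrow uv))
        smooth (inj₂ vu) = proj₁ (level-near x y _ _ (Arc⇒Arrow vu))
        lower : (w : Star (Link G) (enc (hub (tail (fromℕ m′)))) (enc far)) → m + height ≤ len w
        lower w = begin
          m + height                     ≡⟨ level-far ⟨
          level (dec (enc far))          ≤⟨ potential (level ∘ dec) smooth w ⟩
          len w + level (dec (enc _))    ≡⟨ cong (len w +_) level-tail ⟩
          len w + 0                      ≡⟨ ℕ.+-identityʳ _ ⟩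
          len w                          ∎
          where open ℕ.≤-Reasoning

      pre : Fin (suc K) → Bool
      pre = prefix false x y

      pre-last : pre (fromℕ K) ≡ dot x y
      pre-last = prefix-last false x y

      -- The invariant of walks from `start`: the bits of a track are the true ones. Hubs are
      -- excluded since no arc leads from a column to them.
      Visited : Vertex → Set
      Visited (fwd (i , b , a) c) = b ≡ pre (inject₁ i) × a ≡ lookup x i
      Visited (ret (i , b) c)     = b ≡ pre i
      Visited (hub _)             = ⊥

      Visited-step : ∀ u v → Base x y u v → Visited u → Visited v
      Visited-step (fwd f c) (fwd .f c′) (refl , _) visited = visited
      Visited-step (fwd (i , b , a) c) (ret _ c′) (refl , _) (b≡ , a≡) =
        trans (cong₂ (λ b a → b xor (a ∧ lookup y i)) b≡ a≡) (sym (prefix-suc false x y i))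
      Visited-step (ret _ c) (fwd (i , b , a) c′) ((refl , a≡) , _) b≡ = b≡ , a≡
      Visited-step (ret g c) (ret .g c′) (refl , _) b≡ = b≡

      -- The `Base` arcs keep the invariant, and the only other arc is the forbidden one.
      no-detour : ∀ {u v} (p : Star (Arc (digraph x y)) u v) → (enc start , enc end) ∉ arcs p →
                  Visited (dec u) → Visited (dec v)
      no-detour ε        st∉ visited = visited
      no-detour {u} (_◅_ {j = z} uz p) st∉ visited with Arc⇒Arrow uz
      ... | inj₁ base = no-detour p (st∉ ∘ there) (Visited-step (dec u) (dec z) base visited)
      ... | inj₂ (us , zt) = contradiction
        (here (cong₂ _,_ (trans (cong enc (sym us)) (enc-dec u)) (trans (cong enc (sym zt)) (enc-dec z)))) st∉

      along-fwd : ∀ k {f} c c′ → toℕ c′ ≡ k + toℕ c → Star (Base x y) (fwd f c) (fwd f c′)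
      along-fwd zero    c c′ eq rewrite Fin.toℕ-injective eq = ε
      along-fwd (suc k) {f} c c′ eq = (refl , Fin.toℕ-fromℕ< c<L) ◅
        along-fwd k (fromℕ< c<L) c′ (trans eq (trans (sym (ℕ.+-suc k _)) (cong (k +_) (sym (Fin.toℕ-fromℕ< c<L)))))
        where
        c<L : suc (toℕ c) < suc L′
        c<L = ℕ.≤-<-trans (s≤s (ℕ.m≤n+m (toℕ c) k)) (subst (_< suc L′) eq (Fin.toℕ<n c′))

      along-ret : ∀ {g} (c : Fin (suc L′)) → Star (Base x y) (ret g c) (ret g zero)
      along-ret {g} = <-weakInduction (λ c → Star (Base x y) (ret g c) (ret g zero)) ε
        λ c p → (refl , cong suc (sym (Fin.toℕ-inject₁ c))) ◅ p

      -- One round trip per coordinate: pick up the bit of `x` in column 0, multiply by that of `y`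
      -- in column L′, return.
      stages : ∀ i → Star (Base x y) start (ret (i , pre i) zero)
      stages = <-weakInduction (λ i → Star (Base x y) start (ret (i , pre i) zero)) ε λ i p →
        p ◅◅ ((refl , refl) , refl , refl) ◅
        (along-fwd L′ {i , pre (inject₁ i) , lookup x i} zero (fromℕ L′)
          (trans (Fin.toℕ-fromℕ L′) (sym (ℕ.+-identityʳ L′))) ◅◅
        (cong (suc i ,_) (prefix-suc false x y i) , refl , Fin.toℕ-fromℕ L′) ◅ along-ret (fromℕ L′))

      detour-walk : dot x y ≡ true → Star (Base x y) start end
      detour-walk isdot = subst (λ b → Star (Base x y) start (ret (fromℕ K , b) zero))
        (trans pre-last isdot) (stages (fromℕ K))

      st-arc : Arc (digraph x y) (enc start) (enc end)
      st-arc = Arrow⇒Arc (inj₂ (dec-enc start , dec-enc end))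

      positive-length : ∀ {u v} → u ≢ v → (p : Star (Arc (digraph x y)) u v) → 1 ≤ len p
      positive-length u≢u ε       = contradiction refl u≢u
      positive-length _   (_ ◅ _) = s≤s z≤n

      instance-xy : Instance n
      instance-xy = record
        { graph    = digraph x y
        ; s        = enc start
        ; t        = enc end
        ; Pst      = record { walk = st-arc ◅ ε ; simple = (s≢t ∷ []) ∷ [] ∷ [] }
        ; shortest = λ p → positive-length s≢t (Path.walk p)
        }
        where
        s≢t : enc start ≢ enc end
        s≢t = start≢end ∘ enc-injective

      detour-path : dot x y ≡ true → ∃ (Avoids instance-xy (enc start , enc end))
      detour-path isdot = record { walk = gmap id inc p ; simple = subst Unique (sym (vertices-gmap inc p)) unique } ,
        λ st∈ → ¬Base-start-end x y (subst₂ (Base x y) (dec-enc start) (dec-enc end)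
          (arcs⇒R p (subst (_ ∈_) (arcs-gmap inc p) st∈)))
        where
        -- Loops are erased within the `Base` arcs, so the simple path still avoids the edge from
        -- `start` to `end`.
        Baseᵢ : Rel (Fin n) 0ℓ
        Baseᵢ u v = Base x y (dec u) (dec v)
        inc : ∀ {u v} → Baseᵢ u v → Arc (digraph x y) u v
        inc base = Arrow⇒Arc (inj₁ base)
        simple-walk : SimpleWalk {R = Baseᵢ} (enc start) (enc end)
        simple-walk = erase-loops Fin._≟_ (gmap enc
          (λ {u} {v} base → subst₂ (Base x y) (sym (dec-enc u)) (sym (dec-enc v)) base) (detour-walk isdot))
        p = proj₁ simple-walk
        unique = proj₂ simple-walk

      no-detour-path : dot x y ≡ false → ¬ ∃ (Avoids instance-xy (enc start , enc end))
      no-detour-path isdot (p , st∉) = contradiction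
        (trans (subst Visited (dec-enc end) (no-detour (Path.walk p) st∉ (subst Visited (sym (dec-enc start)) refl)))
               (trans pre-last isdot)) λ ()

    view-cong : ∀ x y x′ y′ v →
      (∀ u → does (arrow? x y (dec v) (dec u)) ≡ does (arrow? x′ y′ (dec v) (dec u))) →
      (∀ u → does (arrow? x y (dec u) (dec v)) ≡ does (arrow? x′ y′ (dec u) (dec v))) →
      view (instance-xy x y) v ≡ view (instance-xy x′ y′) v
    view-cong x y x′ y′ v outs ins = cong₂ (λ o i → record
      { self = v ; outArcs = o ; inArcs = i ; source = enc start ; target = enc end
      ; pathEdges = (enc start , enc end) ∷ [] }) (Vec.tabulate-cong outs)
      (Vec.tabulate-cong λ u → trans (Vec.lookup∘tabulate _ v) (trans (ins u) (sym (Vec.lookup∘tabulate _ v))))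

    -- Only messages from a child to its parent are fed. In the other direction `up-lo` and `up-hi`
    -- place the parent inside the previous region. `root` is a mere default where a node has no
    -- parent.
    feed : Node → Fin n × Fin n
    feed c = enc (hub (spine c)) , enc (hub (spine (Maybe.fromMaybe root (parent c))))

    feed-parent : ∀ {u v c p} → dec u ≡ hub (spine c) → dec v ≡ hub (spine p) → parent c ≡ just p →
                  feed c ≡ (u , v)
    feed-parent {u} {v} {c} {p} du dv eq rewrite eq =
      cong₂ _,_ (trans (cong enc (sym du)) (enc-dec u)) (trans (cong enc (sym dv)) (enc-dec v))

    cut : Cut instance-xy
    cut = record
      { L          = suc L′
      ; w          = width
      ; lo         = low ∘ dec
      ; hi         = high ∘ dec
      ; lo≤hi      = low≤high ∘ dec
      ; view-left  = λ x y y′ v left → view-cong x y x y′ v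
          (λ u → same-left x y y′ (dec v) (dec u) (inj₁ left)) (λ u → same-left x y y′ (dec u) (dec v) (inj₂ left))
      ; view-right = λ x x′ y v right → view-cong x y x′ y v
          (λ u → same-right x x′ y (dec v) (dec u) (inj₁ right)) (λ u → same-right x x′ y (dec u) (dec v) (inj₂ right))
      -- For θ = L′ - τ, a child is outside the left region at time τ when θ ≤ `lo`, and its parent
      -- inside at time τ + 1 when `lo` + 1 < θ. For the right regions the threshold is τ + 1.
      ; feedˡ      = λ τ i → feed (cross (L′ ∸ τ) i)
      ; feedʳ      = λ τ i → feed (cross (suc τ) i)
      ; link-left  = link-left
      ; link-right = link-right
      }
      where
      same-left : ∀ x y y′ u v → suc (low u) < suc L′ ⊎ suc (low v) < suc L′ →
                  does (arrow? x y u v) ≡ does (arrow? x y′ u v)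
      same-left x y y′ u v left = does-⇔ (mk⇔ (Sum.map₁ (Base-left x y y′ u v left))
        (Sum.map₁ (Base-left x y′ y u v left))) (arrow? x y u v) (arrow? x y′ u v)
      same-right : ∀ x x′ y u v → 0 < high u ⊎ 0 < high v →
                   does (arrow? x y u v) ≡ does (arrow? x′ y u v)
      same-right x x′ y u v right = does-⇔ (mk⇔ (Sum.map₁ (Base-right x x′ y u v right))
        (Sum.map₁ (Base-right x′ x y u v right))) (arrow? x y u v) (arrow? x′ y u v)

      shift-left : ∀ {τ j k} → j ≤ suc k → suc (suc τ) + k < suc L′ → suc τ + j < suc L′
      shift-left {τ} {j} {k} j≤ left =
        ℕ.≤-<-trans (ℕ.≤-trans (ℕ.+-monoʳ-≤ (suc τ) j≤) (ℕ.≤-reflexive (ℕ.+-suc (suc τ) k))) left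

      link-left : ∀ x y τ u v → Link (digraph x y) u v → suc (suc τ) + low (dec v) < suc L′ →
                  suc τ + low (dec u) < suc L′ ⊎ ∃ λ i → feed (cross (L′ ∸ τ) i) ≡ (u , v)
      link-left x y τ u v (inj₁ uv) left with Arrow-near x y (dec u) (dec v) (Arc⇒Arrow uv)
      ... | inj₁ (near , _) = inj₁ (shift-left (proj₁ near) left)
      ... | inj₂ (p , c , du , dv , eq) rewrite du | dv = inj₁ (shift-left (up-lo eq) left)
      link-left x y τ u v (inj₂ vu) left with Arrow-near x y (dec v) (dec u) (Arc⇒Arrow vu)
      ... | inj₁ (near , _) = inj₁ (shift-left (proj₂ near) left)
      ... | inj₂ (p , c , dv , du , eq) with suc τ + low (dec u) <? suc L′
      ...   | yes leftᵤ = inj₁ leftᵤ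
      ...   | no ¬left with down-lo eq (L′ ∸ τ)
              (ℕ.m+n≤o⇒m≤o∸n (suc (suc (lo p))) (ℕ.≤-trans (ℕ.≤-reflexive reorder)
                (ℕ.s≤s⁻¹ (subst (λ v → suc (suc τ) + low v < suc L′) dv left))))
              (ℕ.m≤n+o⇒m∸n≤o L′ τ (ℕ.s≤s⁻¹ (subst (λ v → suc L′ ≤ suc τ + low v) du (ℕ.≮⇒≥ ¬left))))
        where
        reorder : suc (suc (lo p)) + τ ≡ suc (suc (τ + lo p))
        reorder = cong (λ k → suc (suc k)) (ℕ.+-comm (lo p) τ)
      ...     | i , refl = inj₂ (i , feed-parent du dv eq)

      link-right : ∀ x y τ u v → Link (digraph x y) u v → suc τ < high (dec v) →
                   τ < high (dec u) ⊎ ∃ λ i → feed (cross (suc τ) i) ≡ (u , v)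
      link-right x y τ u v (inj₁ uv) right with Arrow-near x y (dec u) (dec v) (Arc⇒Arrow uv)
      ... | inj₁ (_ , near) = inj₁ (ℕ.s<s⁻¹ (ℕ.<-≤-trans right (proj₂ near)))
      ... | inj₂ (p , c , du , dv , eq) rewrite du | dv = inj₁ (ℕ.s<s⁻¹ (ℕ.<-≤-trans right (up-hi eq)))
      link-right x y τ u v (inj₂ vu) right with Arrow-near x y (dec v) (dec u) (Arc⇒Arrow vu)
      ... | inj₁ (_ , near) = inj₁ (ℕ.s<s⁻¹ (ℕ.<-≤-trans right (proj₁ near)))
      ... | inj₂ (p , c , dv , du , eq) with τ <? high (dec u)
      ...   | yes rightᵤ = inj₁ rightᵤ
      ...   | no ¬right with down-hi eq (suc τ)
              (s≤s (subst (λ v → high v ≤ τ) du (ℕ.≮⇒≥ ¬right))) (subst (λ v → suc τ < high v) dv right)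
      ...     | i , refl = inj₂ (i , feed-parent du dv eq)

    hardFamily : HardFamily n (m + height) K
    hardFamily = record
      { I        = instance-xy
      ; cut      = cut
      ; class    = λ x y → diameter x y , refl
      ; s₀       = enc start
      ; t₀       = enc end
      ; s≡       = λ _ _ → refl
      ; t≡       = λ _ _ → refl
      ; single   = λ _ _ → refl
      ; detour   = detour-path
      ; noDetour = no-detour-path
      }

  -- Path spines and tree spines.

  toℕ-mod : ∀ c n .{{_ : ℕ.NonZero n}} → c < n → toℕ (c mod n) ≡ c
  toℕ-mod c n c<n = trans (Fin.toℕ-fromℕ< (m%n<n c n)) (m<n⇒m%n≡m c<n)

  vertexCode : ∀ {L′} (S : Spine (suc L′)) K m′ q (H≤m : Spine.height S ≤ suc m′) →
               Family.Vertex S K m′ q H≤m ↔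
               Fin ((K * (2 * 2) + suc K * 2) * suc L′ + (Spine.size S + (suc m′ + q)))
  vertexCode S K m′ q _ = sum (prod (sum (prod (↔-refl) (prod bool bool)) (prod ↔-refl bool)) ↔-refl)
                              (sum (Spine.code S) (sum ↔-refl ↔-refl))
    where
    sum : ∀ {A B : Set} {a b} → A ↔ Fin a → B ↔ Fin b → (A ⊎ B) ↔ Fin (a + b)
    sum f g = ↔-trans (f ⊎-↔ g) (↔-sym Fin.+↔⊎)
    prod : ∀ {A B : Set} {a b} → A ↔ Fin a → B ↔ Fin b → (A × B) ↔ Fin (a * b)
    prod f g = ↔-trans (f ×-↔ g) (↔-sym Fin.*↔×)
    bool : Bool ↔ Fin 2
    bool = ↔-sym Fin.2↔Bool

  -- Every node belongs to its own column alone, so a spine link spans one column and nothing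
  -- crosses; the price is a height of L.
  pathSpine : ∀ L′ → Spine (suc L′)
  pathSpine L′ = record
    { Node = Fin (suc L′) ; size = suc L′ ; code = ↔-refl ; root = zero
    ; parent = parent ; depth = toℕ ; depth-root = refl ; depth-parent = depth-parent ; climb = climb
    ; leaf = _mod suc L′
    ; leaf-smooth = λ c lt → subst₂ (λ j k → j ≤ suc k × k ≤ suc j)
        (sym (toℕ-mod c (suc L′) (ℕ.<⇒≤ lt))) (sym (toℕ-mod (suc c) (suc L′) lt))
        (ℕ.m≤n⇒m≤1+n (ℕ.n≤1+n c) , ℕ.≤-refl)
    ; height = suc L′ ; depth<height = Fin.toℕ<n
    ; deepest = L′ , ℕ.≤-refl , cong suc (toℕ-mod L′ (suc L′) ℕ.≤-refl)
    ; lo = toℕ ; hi = toℕ ; lo≤hi = λ _ → ℕ.≤-refl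
    ; lo-leaf = λ c → toℕ-mod c (suc L′) ; hi-leaf = λ c → toℕ-mod c (suc L′)
    ; width = 0 ; cross = λ _ ()
    ; up-lo = λ eq → ℕ.m≤n⇒m≤1+n (ℕ.≤-trans (ℕ.n≤1+n _) (ℕ.≤-reflexive (sym (depth-parent eq))))
    ; up-hi = λ eq → ℕ.≤-reflexive (depth-parent eq)
    ; down-lo = λ eq θ lt le → contradiction (subst (θ ≤_) (depth-parent eq) le) (ℕ.<⇒≱ lt)
    ; down-hi = λ eq θ lt lt′ → contradiction lt′
        (ℕ.<⇒≯ (ℕ.<-trans (ℕ.≤-reflexive (sym (depth-parent eq))) lt))
    }
    where
    parent : ∀ {n} → Fin (suc n) → Maybe (Fin (suc n))
    parent zero            = nothing
    parent {suc n} (suc i) = just (inject₁ i)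
    depth-parent : ∀ {n} {v p : Fin (suc n)} → parent v ≡ just p → toℕ v ≡ suc (toℕ p)
    depth-parent {suc n} {suc i} refl = cong suc (sym (Fin.toℕ-inject₁ i))
    climb : ∀ {n} (v : Fin (suc n)) → v ≡ zero ⊎ ∃ λ p → parent v ≡ just p
    climb zero            = inj₁ refl
    climb {suc n} (suc i) = inj₂ (inject₁ i , refl)

  module Tree (d : ℕ) .{{_ : ℕ.NonZero d}} where

    module _ (h : ℕ) where

      private instance
        d^h≢0 : ℕ.NonZero (d ^ h)
        d^h≢0 = ℕ.m^n≢0 d h

      quo rem : ℕ → ℕ
      quo c = c / d ^ h
      rem c = c % d ^ h

      rem< : ∀ c → rem c < d ^ h
      rem< c = m%n<n c (d ^ h)

      quo< : ∀ {c} → c < d ^ suc h → quo c < d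
      quo< = m<n*o⇒m/o<n

      quo-rem : ∀ c → quo c * d ^ h + rem c ≡ c
      quo-rem c = trans (ℕ.+-comm _ (rem c)) (sym (m≡m%n+[m/n]*n c (d ^ h)))

      rem-unique : ∀ i {ρ} → ρ < d ^ h → rem (i * d ^ h + ρ) ≡ ρ
      rem-unique i {ρ} ρ< = trans (cong rem (ℕ.+-comm (i * d ^ h) ρ))
                           (trans ([m+kn]%n≡m%n ρ i (d ^ h)) (m<n⇒m%n≡m ρ<))

      quo-unique : ∀ i {ρ} → ρ < d ^ h → quo (i * d ^ h + ρ) ≡ i
      quo-unique i {ρ} ρ< = begin
        (i * d ^ h + ρ) / d ^ h          ≡⟨ cong quo (ℕ.+-comm (i * d ^ h) ρ) ⟩
        (ρ + i * d ^ h) / d ^ h          ≡⟨ +-distrib-/-∣ʳ ρ {i * d ^ h} {d ^ h} (n∣m*n i) ⟩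
        ρ / d ^ h + i * d ^ h / d ^ h    ≡⟨ cong₂ _+_ (m<n⇒m/n≡0 ρ<) (m*n/n≡m i (d ^ h)) ⟩
        i                                ∎
        where open ≡-Reasoning

    Node : ℕ → Set
    Node zero    = ⊤
    Node (suc h) = ⊤ ⊎ (Fin d × Node h)

    size : ℕ → ℕ
    size zero    = 1
    size (suc h) = 1 + d * size h

    code : ∀ h → Node h ↔ Fin (size h)
    code zero    = ↔-sym Fin.1↔⊤
    code (suc h) = ↔-trans (↔-sym Fin.1↔⊤ ⊎-↔ ↔-trans (↔-refl ×-↔ code h) (↔-sym Fin.*↔×)) (↔-sym Fin.+↔⊎)

    root : ∀ h → Node h
    root zero    = tt
    root (suc h) = inj₁ tt

    parent : ∀ h → Node h → Maybe (Node h)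
    parent zero    _              = nothing
    parent (suc h) (inj₁ _)       = nothing
    parent (suc h) (inj₂ (i , v)) = just (Maybe.maybe′ (λ p → inj₂ (i , p)) (inj₁ tt) (parent h v))

    depth : ∀ h → Node h → ℕ
    depth zero    _              = 0
    depth (suc h) (inj₁ _)       = 0
    depth (suc h) (inj₂ (_ , v)) = suc (depth h v)

    climb : ∀ h v → v ≡ root h ⊎ ∃ λ p → parent h v ≡ just p
    climb zero    _        = inj₁ refl
    climb (suc h) (inj₁ _) = inj₁ refl
    climb (suc h) (inj₂ _) = inj₂ (_ , refl)

    depth-root : ∀ h → depth h (root h) ≡ 0
    depth-root zero    = refl
    depth-root (suc h) = refl

    depth-parent : ∀ h {v p} → parent h v ≡ just p → depth h v ≡ suc (depth h p)
    depth-parent (suc h) {inj₂ (i , v)} eq with parent h v in isparent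
    depth-parent (suc h) {inj₂ (i , v)} refl | just p = cong suc (depth-parent h isparent)
    depth-parent (suc h) {inj₂ (i , v)} refl | nothing with climb h v
    ... | inj₁ refl     = cong suc (depth-root h)
    ... | inj₂ (_ , eq) = contradiction (trans (sym isparent) eq) λ ()

    depth≤ : ∀ h v → depth h v ≤ h
    depth≤ zero    _              = z≤n
    depth≤ (suc h) (inj₁ _)       = z≤n
    depth≤ (suc h) (inj₂ (_ , v)) = s≤s (depth≤ h v)

    -- The descent to a leaf spells its column in base `d`, leading digit first.
    leaf : ∀ h → ℕ → Node h
    leaf zero    c = tt
    leaf (suc h) c = inj₂ (quo h c mod d , leaf h (rem h c))

    depth-leaf : ∀ h c → depth h (leaf h c) ≡ h
    depth-leaf zero    c = refl
    depth-leaf (suc h) c = cong suc (depth-leaf h _)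

    lo hi : ∀ h → Node h → ℕ
    lo zero    _              = 0
    lo (suc h) (inj₁ _)       = 0
    lo (suc h) (inj₂ (i , v)) = toℕ i * d ^ h + lo h v
    hi zero    _              = 0
    hi (suc h) (inj₁ _)       = ℕ.pred (d ^ suc h)
    hi (suc h) (inj₂ (i , v)) = toℕ i * d ^ h + hi h v

    lo≤hi : ∀ h v → lo h v ≤ hi h v
    lo≤hi zero    _              = z≤n
    lo≤hi (suc h) (inj₁ _)       = z≤n
    lo≤hi (suc h) (inj₂ (i , v)) = ℕ.+-monoʳ-≤ (toℕ i * d ^ h) (lo≤hi h v)

    hi< : ∀ h v → hi h v < d ^ h
    hi< zero    _              = s≤s z≤n
    hi< (suc h) (inj₁ _)       = ℕ.≤-reflexive (ℕ.suc-pred (d ^ suc h) {{ℕ.m^n≢0 d (suc h)}})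
    hi< (suc h) (inj₂ (i , v)) = begin-strict
      toℕ i * d ^ h + hi h v  <⟨ ℕ.+-monoʳ-< (toℕ i * d ^ h) (hi< h v) ⟩
      toℕ i * d ^ h + d ^ h   ≡⟨ ℕ.+-comm (toℕ i * d ^ h) (d ^ h) ⟩
      suc (toℕ i) * d ^ h     ≤⟨ ℕ.*-monoˡ-≤ (d ^ h) (Fin.toℕ<n i) ⟩
      d * d ^ h               ∎
      where open ℕ.≤-Reasoning

    digits : ∀ h c → c < d ^ suc h → toℕ (quo h c mod d) * d ^ h + rem h c ≡ c
    digits h c c<L = trans (cong (λ t → t * d ^ h + rem h c) (toℕ-mod (quo h c) d (quo< h c<L))) (quo-rem h c)

    lo-leaf : ∀ h c → c < d ^ h → lo h (leaf h c) ≡ c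
    lo-leaf zero    zero _   = refl
    lo-leaf zero    (suc c) (s≤s ())
    lo-leaf (suc h) c    c<L = trans (cong (toℕ (quo h c mod d) * d ^ h +_) (lo-leaf h (rem h c) (rem< h c))) (digits h c c<L)

    hi-leaf : ∀ h c → c < d ^ h → hi h (leaf h c) ≡ c
    hi-leaf zero    zero _   = refl
    hi-leaf zero    (suc c) (s≤s ())
    hi-leaf (suc h) c    c<L = trans (cong (toℕ (quo h c mod d) * d ^ h +_) (hi-leaf h (rem h c) (rem< h c))) (digits h c c<L)

    parent-interval : ∀ h {v p} → parent h v ≡ just p → lo h p ≤ lo h v × hi h v ≤ hi h p
    parent-interval (suc h) {inj₂ (i , v)} eq with parent h v in isparent
    parent-interval (suc h) {inj₂ (i , v)} refl | just p with parent-interval h isparent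
    ... | lo≤ , ≤hi = ℕ.+-monoʳ-≤ (toℕ i * d ^ h) lo≤ , ℕ.+-monoʳ-≤ (toℕ i * d ^ h) ≤hi
    parent-interval (suc h) {inj₂ (i , v)} refl | nothing = z≤n , ℕ.<⇒≤pred (hi< (suc h) (inj₂ (i , v)))

    -- A threshold that separates a node from its parent lies in the interval of the parent, and the
    -- intervals of one level are disjoint. So the `d` children of each inner node above leaf θ
    -- suffice.
    cross : ∀ h → ℕ → Fin (h * d) → Node h
    cross (suc h) θ = Sum.[ (λ i → inj₂ (i , root h)) , (λ j → inj₂ (quo h θ mod d , cross h (rem h θ) j)) ]′
                      ∘ Fin.splitAt d

    cross-complete : ∀ h {v p} → parent h v ≡ just p → ∀ θ → lo h p ≤ θ → θ ≤ hi h p → ∃ λ i → cross h θ i ≡ v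
    cross-complete (suc h) {inj₂ (i , v)} eq θ lo≤θ θ≤hi with parent h v in isparent
    cross-complete (suc h) {inj₂ (i , v)} eq θ lo≤θ θ≤hi | nothing with climb h v
    ... | inj₁ refl = i Fin.↑ˡ (h * d) ,
      cong Sum.[ _ , _ ]′ (Fin.splitAt-↑ˡ d i (h * d))
    ... | inj₂ (_ , eq′) = contradiction (trans (sym isparent) eq′) λ ()
    cross-complete (suc h) {inj₂ (i , v)} refl θ lo≤θ θ≤hi | just p
      with θ ∸ toℕ i * d ^ h | ℕ.m+[n∸m]≡n (ℕ.≤-trans (ℕ.m≤m+n _ (lo h p)) lo≤θ)
    ... | ρ | refl with cross-complete h isparent ρ (ℕ.+-cancelˡ-≤ (toℕ i * d ^ h) _ _ lo≤θ) (ℕ.+-cancelˡ-≤ (toℕ i * d ^ h) _ _ θ≤hi)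
    ...   | j , found = d Fin.↑ʳ j , trans (cong Sum.[ _ , _ ]′ (Fin.splitAt-↑ʳ d (h * d) j))
      (cong₂ (λ i v → inj₂ (i , v))
        (Fin.toℕ-injective (trans (cong (λ t → toℕ (t mod d)) (quo-unique h (toℕ i) ρ<))
                                  (toℕ-mod (toℕ i) d (Fin.toℕ<n i))))
        (trans (cong (λ t → cross h t j) (rem-unique h (toℕ i) ρ<)) found))
      where
      ρ< : ρ < d ^ h
      ρ< = ℕ.≤-<-trans (ℕ.+-cancelˡ-≤ (toℕ i * d ^ h) _ _ θ≤hi) (hi< h p)

    treeSpine : ∀ h {L} → L ≡ d ^ h → Spine L
    treeSpine h eq = record
      { Node = Node h ; size = size h ; code = code h ; root = root h
      ; parent = parent h ; depth = depth h ; depth-root = depth-root h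
      ; depth-parent = depth-parent h ; climb = climb h
      ; leaf = leaf h
      ; leaf-smooth = λ c _ → subst₂ (λ j k → j ≤ suc k × k ≤ suc j)
          (sym (depth-leaf h c)) (sym (depth-leaf h (suc c))) (ℕ.n≤1+n h , ℕ.n≤1+n h)
      ; height = suc h ; depth<height = λ v → s≤s (depth≤ h v)
      ; deepest = 0 , subst (0 <_) (sym eq) (ℕ.m^n>0 d h) , cong suc (depth-leaf h 0)
      ; lo = lo h ; hi = hi h ; lo≤hi = lo≤hi h ; lo-leaf = λ c c<L → lo-leaf h c (subst (c <_) eq c<L)
      ; hi-leaf = λ c c<L → hi-leaf h c (subst (c <_) eq c<L)
      ; width = h * d ; cross = cross h
      ; up-lo = λ eq → ℕ.m≤n⇒m≤1+n (proj₁ (parent-interval h eq))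
      ; up-hi = λ eq → ℕ.m≤n⇒m≤1+n (proj₂ (parent-interval h eq))
      ; down-lo = λ {v} eq θ lt le → cross-complete h eq θ (ℕ.<⇒≤ (ℕ.<-trans (ℕ.n<1+n _) lt))
          (ℕ.≤-trans le (ℕ.≤-trans (lo≤hi h v) (proj₂ (parent-interval h eq))))
      ; down-hi = λ {v} eq θ lt lt′ → cross-complete h eq θ
          (ℕ.≤-trans (proj₁ (parent-interval h eq)) (ℕ.≤-trans (lo≤hi h v) (ℕ.<⇒≤ lt))) (ℕ.<⇒≤ lt′)
      }

    -- The added one lets the induction close, since 2 + d · size ≤ d · (1 + size).
    suc-size≤ : 2 ≤ d → ∀ h → suc (size h) ≤ 2 * d ^ h
    suc-size≤ 2≤d zero    = ℕ.≤-refl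
    suc-size≤ 2≤d (suc h) = begin
      2 + d * size h     ≤⟨ ℕ.+-monoˡ-≤ (d * size h) 2≤d ⟩
      d + d * size h     ≡⟨ ℕ.*-suc d (size h) ⟨
      d * suc (size h)   ≤⟨ ℕ.*-monoʳ-≤ d (suc-size≤ 2≤d h) ⟩
      d * (2 * d ^ h)    ≡⟨ swap d (d ^ h) ⟩
      2 * (d * d ^ h)    ∎
      where
      open ℕ.≤-Reasoning
      swap : ∀ a b → a * (2 * b) ≡ 2 * (a * b)
      swap = ℕ-Solver.solve-∀

  -- Choice of the parameters.

  split-≤ : ∀ {m n} → m ≤ n → ∃ λ k → n ≡ m + k
  split-≤ {m} {n} m≤n = n ∸ m , sym (ℕ.m+[n∸m]≡n m≤n)

  module _ {Π n D T B r} (revealing : Revealing Π) (A : Protocol n B r (Problem.Out Π n))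
           (solves : SolvesWithin Π A T (SingleEdge D)) where

    -- The tail gets m = D - height vertices, so 2 · height ≤ D says that height ≤ m. The room of D
    -- vertices set aside exceeds the tail by height, which goes to the pads together with the
    -- surplus `q`.
    column-bound : ∀ {L′} (S : Spine (suc L′)) K → (let open Spine S) → height + height ≤ D →
      (K * (2 * 2) + suc K * 2) * suc L′ + (size + D) ≤ n →
      8 + 8 * (T * (width * B)) ≤ K → suc L′ ≤ suc (T + T)
    column-bound {L′} S K 2H≤D fits bits≤K = ℕ.≮⇒≥ λ short → impossible (split-≤ 2H≤D) (split-≤ fits) short
      where
      open Spine S
      Tracks : ℕ
      Tracks = (K * (2 * 2) + suc K * 2) * suc L′
      height≡ : height ≡ suc (ℕ.pred height)
      height≡ = sym (ℕ.suc-pred height {{ℕ.>-nonZero (ℕ.≤-<-trans z≤n (depth<height root))}})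
      impossible : (∃ λ e → D ≡ height + height + e) → (∃ λ q → n ≡ Tracks + (size + D) + q) →
                   ¬ suc (T + T) < suc L′
      impossible (e , D≡) (q , n≡) short = ℕ.<⇒≱
        (short-run-impossible revealing (hard m≡ n≡′) T A solves (subst (suc (T + T) <_) (sym (L≡ m≡ n≡′)) short))
        (subst (λ w → 8 + 8 * (T * (w * B)) ≤ K) (sym (w≡ m≡ n≡′)) bits≤K)
        where
        m′ : ℕ
        m′ = ℕ.pred height + e
        H≤m : height ≤ suc m′
        H≤m = ℕ.≤-trans (ℕ.≤-reflexive height≡) (s≤s (ℕ.m≤m+n _ e))
        m≡ : suc m′ + height ≡ D
        m≡ = trans (cong (λ h → h + e + height) (sym height≡)) (trans (rearrange height e) (sym D≡))
          where
          rearrange : ∀ h e → h + e + h ≡ h + h + e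
          rearrange = ℕ-Solver.solve-∀
        n≡′ : Tracks + (size + (suc m′ + (height + q))) ≡ n
        n≡′ = trans (rearrange Tracks size (suc m′) height q)
                    (trans (cong (λ D → Tracks + (size + D) + q) m≡) (sym n≡))
          where
          rearrange : ∀ t s m h q → t + (s + (m + (h + q))) ≡ t + (s + (m + h)) + q
          rearrange = ℕ-Solver.solve-∀
        hard : ∀ {D n} → suc m′ + height ≡ D → Tracks + (size + (suc m′ + (height + q))) ≡ n → HardFamily n D K
        hard refl refl = Instances.hardFamily S K m′ (height + q) H≤m (vertexCode S K m′ (height + q) H≤m)
        L≡ : ∀ {D n} (p : suc m′ + height ≡ D) (p′ : _ ≡ n) → HardFamily.L (hard p p′) ≡ suc L′
        L≡ refl refl = refl
        w≡ : ∀ {D n} (p : suc m′ + height ≡ D) (p′ : _ ≡ n) → HardFamily.w (hard p p′) ≡ width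
        w≡ refl refl = refl

  n<2^n : ∀ n → n < 2 ^ n
  n<2^n zero    = s≤s z≤n
  n<2^n (suc n) = begin-strict
    suc n          ≤⟨ n<2^n n ⟩
    2 ^ n          <⟨ ℕ.m<m+n (2 ^ n) (ℕ.≤-trans (ℕ.m^n>0 2 n) (ℕ.m≤m+n _ 0)) ⟩
    2 ^ suc n      ∎
    where open ℕ.≤-Reasoning

  threshold : {P : ℕ → Set} → (∀ h → Dec (P h)) → P 0 → ∀ N → ¬ P N → ∃ λ h → P h × ¬ P (suc h)
  threshold P? p0 zero    ¬p = contradiction p0 ¬p
  threshold P? p0 (suc N) ¬p with P? N
  ... | yes p = N , p , ¬p
  ... | no ¬q = threshold P? p0 N ¬q

  module Bounds {Π} (revealing : Revealing Π) (β k : ℕ) .{{k≢0 : ℕ.NonZero k}} where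

    -- A tree of degree d has height at most log n / 8k ≤ D / 8.
    d C c₁ c₂ n₀ : ℕ
    d  = 2 ^ (8 * k)
    C  = 52 + 48 * d * β
    c₁ = 204 * k
    c₂ = k * C * (3 * d)
    n₀ = 2 ^ (102 * k * k)

    1≤k : 1 ≤ k
    1≤k = ℕ.>-nonZero⁻¹ k

    module _ {n D T r : ℕ} (n₀≤n : n₀ ≤ n) (logD : ⌈log₂ n ⌉ ≤ k * D) (spare : n ≤ k * (n ∸ D))
             (A : Protocol n (β * ⌈log₂ n ⌉) r (Problem.Out Π n))
             (solves : SolvesWithin Π A T (SingleEdge D)) where

      ℓ : ℕ
      ℓ = ⌈log₂ n ⌉

      log-≤ : ∀ j → 2 ^ j ≤ n → j ≤ ℓ
      log-≤ j 2^j≤n = subst (_≤ ℓ) (⌈log₂2^n⌉≡n j) (⌈log₂⌉-mono-≤ 2^j≤n)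

      -- `n₀` is chosen for this: log n is at least 102k² and at most kD. Then D / (51k) is at least
      -- 2, and already two columns force a round.
      102k≤D : 102 * k ≤ D
      102k≤D = ℕ.*-cancelˡ-≤ k (ℕ.≤-trans (ℕ.≤-reflexive (ℕ.*-comm k (102 * k))) (ℕ.≤-trans (log-≤ _ n₀≤n) logD))

      1≤ℓ : 1 ≤ ℓ
      1≤ℓ = ℕ.≤-trans (ℕ.*-mono-≤ (ℕ.*-mono-≤ {1} {102} (s≤s z≤n) 1≤k) 1≤k) (log-≤ _ n₀≤n)

      D≤n : D ≤ n
      D≤n with ℕ.≤-total D n
      ... | inj₁ D≤n = D≤n
      ... | inj₂ n≤D = contradiction
        (ℕ.≤-trans (ℕ.m^n>0 2 (102 * k * k)) (ℕ.≤-trans n₀≤n (ℕ.≤-trans spare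
          (ℕ.≤-reflexive (trans (cong (k *_) (ℕ.m≤n⇒m∸n≡0 n≤D)) (ℕ.*-zeroʳ k)))))) λ ()

      -- By `spare`, at least n/k vertices are left besides the D that `column-bound` sets aside.
      fits : ∀ {a} → k * a ≤ n → a + D ≤ n
      fits {a} ka≤n = ℕ.≤-trans (ℕ.+-monoˡ-≤ D (ℕ.*-cancelˡ-≤ k (ℕ.≤-trans ka≤n spare)))
                            (ℕ.≤-reflexive (ℕ.m∸n+n≡m D≤n))

      -- The path spine, which has no shortcuts, gives the linear bound in D.
      quotient-bound : ∀ L → L * (51 * k) ≤ D → D < suc L * (51 * k) → D ≤ c₁ * T × 1 ≤ T
      quotient-bound zero    _     D< = contradiction (ℕ.≤-trans (ℕ.*-monoˡ-≤ k {51} {102} (ℕ.m≤m+n 51 51)) 102k≤D)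
        (ℕ.<⇒≱ (subst (D <_) (ℕ.*-identityˡ (51 * k)) D<))
      quotient-bound (suc zero) _  D< = contradiction 102k≤D (ℕ.<⇒≱ (subst (D <_) (sym (ℕ.*-assoc 2 51 k)) D<))
      quotient-bound (suc (suc L′)) ≤D D< = ≤c₁T T L≤ , 1≤T T L≤
        where
        L = suc (suc L′)
        ka≤n : k * (51 * L) ≤ n
        ka≤n = ℕ.≤-trans (ℕ.≤-reflexive (rearrange k L)) (ℕ.≤-trans ≤D D≤n)
          where
          rearrange : ∀ k L → k * (51 * L) ≡ L * (51 * k)
          rearrange = ℕ-Solver.solve-∀
        2L≤D : L + L ≤ D
        2L≤D = begin
          L + L          ≡⟨ double L ⟩
          L * 2          ≤⟨ ℕ.*-monoʳ-≤ L (ℕ.*-mono-≤ {2} {51} (ℕ.m≤m+n 2 49) 1≤k) ⟩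
          L * (51 * k)   ≤⟨ ≤D ⟩
          D              ∎
          where
          open ℕ.≤-Reasoning
          double : ∀ L → L + L ≡ L * 2
          double = ℕ-Solver.solve-∀
        L≤ : L ≤ suc (T + T)
        -- With width 0 only the constant 8 is required of K. This makes 6 · 8 + 2 = 50 tracks, and
        -- with the spine 51 vertices per column.
        L≤ = column-bound {T = T} revealing A solves (pathSpine (suc L′)) 8 2L≤D
          (ℕ.≤-trans (ℕ.≤-reflexive (rearrange L D)) (fits ka≤n))
          (ℕ.≤-reflexive (cong (8 +_) (cong (8 *_) (ℕ.*-zeroʳ T))))
          where
          rearrange : ∀ L D → 50 * L + (L + D) ≡ 51 * L + D
          rearrange = ℕ-Solver.solve-∀
        1≤T : ∀ T → L ≤ suc (T + T) → 1 ≤ T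
        1≤T zero    (s≤s ())
        1≤T (suc T) _ = s≤s z≤n
        ≤c₁T : ∀ T → L ≤ suc (T + T) → D ≤ c₁ * T
        ≤c₁T T L≤ = begin
          D                            ≤⟨ ℕ.<⇒≤ D< ⟩
          suc L * (51 * k)             ≤⟨ ℕ.*-monoˡ-≤ (51 * k) (s≤s L≤) ⟩
          -- The origin of `c₁`: 2T + 2 ≤ 4T, and 4 · 51 = 204.
          (2 + (T + T)) * (51 * k)     ≤⟨ ℕ.*-monoˡ-≤ (51 * k) (ℕ.+-monoˡ-≤ (T + T) (ℕ.+-mono-≤ (1≤T T L≤) (1≤T T L≤))) ⟩
          (T + T + (T + T)) * (51 * k) ≡⟨ rearrange T k ⟩
          204 * k * T                  ∎
          where
          open ℕ.≤-Reasoning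
          rearrange : ∀ T k → (T + T + (T + T)) * (51 * k) ≡ 204 * k * T
          rearrange = ℕ-Solver.solve-∀

      diameter-bound : D ≤ c₁ * T × 1 ≤ T
      diameter-bound = quotient-bound (D / (51 * k)) (m/n*n≤m D (51 * k)) (begin-strict
        D                                            ≡⟨ m≡m%n+[m/n]*n D (51 * k) ⟩
        D % (51 * k) + D / (51 * k) * (51 * k) <⟨ ℕ.+-monoˡ-< (D / (51 * k) * (51 * k)) (m%n<n D (51 * k)) ⟩
        suc (D / (51 * k)) * (51 * k)                ∎)
        where
        open ℕ.≤-Reasoning
        instance
          51k≢0 : ℕ.NonZero (51 * k)
          51k≢0 = ℕ.m*n≢0 51 k

      -- `C` · E² · ℓ² bounds the vertices in the tracks and the tree for E columns; the factor `k`
      -- leaves room for D.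
      Small : ℕ → Set
      Small E = k * (C * (E * E * (ℓ * ℓ))) ≤ n

      1≤d : 1 ≤ d
      1≤d = ℕ.m^n>0 2 (8 * k)

      -- K is computed from L in place of T, so that the size of the graph is under control. If T <
      -- L, it exceeds the needs of T rounds; otherwise the claim is immediate.
      L-bound : ∀ h → Small (d ^ h) → d ^ h ≤ suc (T + T)
      L-bound h small with T <? d ^ h
      ... | no T≮L  = ℕ.≤-trans (ℕ.≮⇒≥ T≮L) (ℕ.m≤n⇒m≤1+n (ℕ.m≤m+n T T))
      ... | yes T<L = go (ℕ.pred (d ^ h)) (ℕ.suc-pred (d ^ h) {{ℕ.>-nonZero 1≤L}})
        where
        open ℕ.≤-Reasoning
        L = d ^ h
        K = 8 + 8 * (L * (h * d * (β * ℓ)))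
        1≤L : 1 ≤ L
        1≤L = ℕ.m^n>0 d {{ℕ.>-nonZero 1≤d}} h
        L≤n : L ≤ n
        L≤n = begin
          L                                 ≡⟨ ℕ.*-identityʳ L ⟨
          L * 1                             ≤⟨ ℕ.*-monoʳ-≤ L 1≤L ⟩
          L * L                             ≡⟨ ones (L * L) ⟩
          1 * (1 * (L * L * (1 * 1)))       ≤⟨ ℕ.*-mono-≤ 1≤k (ℕ.*-mono-≤ {1} {C} (s≤s z≤n)
                                                 (ℕ.*-monoʳ-≤ (L * L) (ℕ.*-mono-≤ 1≤ℓ 1≤ℓ))) ⟩
          k * (C * (L * L * (ℓ * ℓ)))       ≤⟨ small ⟩
          n                                 ∎
          where
          ones : ∀ a → a ≡ 1 * (1 * (a * (1 * 1)))
          ones = ℕ-Solver.solve-∀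
        8kh≤ℓ : 8 * k * h ≤ ℓ
        8kh≤ℓ = log-≤ (8 * k * h) (subst (_≤ n) (ℕ.^-*-assoc 2 (8 * k) h) L≤n)
        h≤ℓ : h ≤ ℓ
        h≤ℓ = ℕ.≤-trans (ℕ.≤-trans (ℕ.≤-reflexive (sym (ℕ.*-identityˡ h)))
                            (ℕ.*-monoˡ-≤ h (ℕ.*-mono-≤ {1} {8} (s≤s z≤n) 1≤k))) 8kh≤ℓ
        8h≤D : 8 * h ≤ D
        8h≤D = ℕ.*-cancelˡ-≤ k (ℕ.≤-trans (ℕ.≤-reflexive (rearrange k h)) (ℕ.≤-trans 8kh≤ℓ logD))
          where
          rearrange : ∀ k h → k * (8 * h) ≡ 8 * k * h
          rearrange = ℕ-Solver.solve-∀
        8≤D : 8 ≤ D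
        8≤D = ℕ.≤-trans (ℕ.*-mono-≤ {8} {102} (ℕ.m≤m+n 8 94) 1≤k) 102k≤D
        2H≤D : suc h + suc h ≤ D
        2H≤D = ℕ.*-cancelˡ-≤ 4 (begin
          4 * (suc h + suc h)    ≡⟨ rearrange h ⟩
          8 * h + 8              ≤⟨ ℕ.+-mono-≤ 8h≤D 8≤D ⟩
          D + D                  ≤⟨ ℕ.m≤m+n (D + D) (D + D) ⟩
          D + D + (D + D)        ≡⟨ four D ⟩
          4 * D                  ∎)
          where
          rearrange : ∀ h → 4 * (suc h + suc h) ≡ 8 * h + 8
          rearrange = ℕ-Solver.solve-∀
          four : ∀ D → D + D + (D + D) ≡ 4 * D
          four = ℕ-Solver.solve-∀
        enough : 8 + 8 * (T * (h * d * (β * ℓ))) ≤ K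
        enough = ℕ.+-monoʳ-≤ 8 (ℕ.*-monoʳ-≤ 8 (ℕ.*-monoˡ-≤ (h * d * (β * ℓ)) (ℕ.<⇒≤ T<L)))
        2≤d : 2 ≤ d
        2≤d = ℕ.^-monoʳ-≤ 2 (ℕ.*-mono-≤ {1} {8} (s≤s z≤n) 1≤k)
        open Tree d {{ℕ.>-nonZero 1≤d}} using (treeSpine; suc-size≤; size)
        room : (K * (2 * 2) + suc K * 2) * L + (size h + D) ≤ n
        room = begin
          (K * (2 * 2) + suc K * 2) * L + (size h + D)
            ≤⟨ ℕ.+-monoʳ-≤ ((K * (2 * 2) + suc K * 2) * L) (ℕ.+-monoˡ-≤ D (ℕ.≤-trans (ℕ.n≤1+n _) (suc-size≤ 2≤d h))) ⟩
          (K * (2 * 2) + suc K * 2) * L + (2 * L + D)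
            -- The origin of `C`: 6K + 2 is 50 + 48 L h d β ℓ, and the tree adds at most 2 vertices
            -- per column.
            ≡⟨ rearrange L h d β ℓ D ⟩
          52 * (L * 1 * (1 * 1)) + 48 * d * β * (L * L * (h * ℓ)) + D
            ≤⟨ ℕ.+-monoˡ-≤ D (ℕ.+-mono-≤
                 (ℕ.*-monoʳ-≤ 52 (ℕ.*-mono-≤ (ℕ.*-monoʳ-≤ L 1≤L) (ℕ.*-mono-≤ 1≤ℓ 1≤ℓ)))
                 (ℕ.*-monoʳ-≤ (48 * d * β) (ℕ.*-monoʳ-≤ (L * L) (ℕ.*-monoˡ-≤ ℓ h≤ℓ)))) ⟩
          52 * (L * L * (ℓ * ℓ)) + 48 * d * β * (L * L * (ℓ * ℓ)) + D
            ≡⟨ cong (_+ D) (ℕ.*-distribʳ-+ (L * L * (ℓ * ℓ)) 52 (48 * d * β)) ⟨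
          C * (L * L * (ℓ * ℓ)) + D
            ≤⟨ fits small ⟩
          n ∎
          where
          rearrange : ∀ L h d β ℓ D →
            ((8 + 8 * (L * (h * d * (β * ℓ)))) * (2 * 2) + suc (8 + 8 * (L * (h * d * (β * ℓ)))) * 2) * L + (2 * L + D)
              ≡ 52 * (L * 1 * (1 * 1)) + 48 * d * β * (L * L * (h * ℓ)) + D
          rearrange = ℕ-Solver.solve-∀
        go : ∀ L′ → suc L′ ≡ L → L ≤ suc (T + T)
        go L′ eq = subst (_≤ suc (T + T)) eq
          (column-bound {T = T} revealing A solves (treeSpine h eq) K 2H≤D
            (subst (λ L → (K * (2 * 2) + suc K * 2) * L + (size h + D) ≤ n) (sym eq) room) enough)

      1≤T : 1 ≤ T
      1≤T = proj₂ diameter-bound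

      -- Replacing kC by its square makes the right side a perfect square; its root has the constant
      -- `c₂` = kC · 3d.
      square-bound : ∀ E → E ≤ 3 * d * T → n ≤ k * (C * (E * E * (ℓ * ℓ))) → n ≤ (c₂ * T * ℓ) ^ 2
      square-bound E E≤ n≤ = begin
        n                                                  ≤⟨ n≤ ⟩
        k * (C * (E * E * (ℓ * ℓ)))                        ≡⟨ ones k C E ℓ ⟩
        1 * (k * C) * (E * E * (ℓ * ℓ))
          ≤⟨ ℕ.*-mono-≤ (ℕ.*-monoˡ-≤ (k * C) (ℕ.*-mono-≤ 1≤k (s≤s {n = 51 + 48 * d * β} z≤n)))
                        (ℕ.*-monoˡ-≤ (ℓ * ℓ) (ℕ.*-mono-≤ E≤ E≤)) ⟩
        k * C * (k * C) * (3 * d * T * (3 * d * T) * (ℓ * ℓ)) ≡⟨ square (k * C) (3 * d) T ℓ ⟩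
        (c₂ * T * ℓ) ^ 2                                   ∎
        where
        open ℕ.≤-Reasoning
        ones : ∀ k C E ℓ → k * (C * (E * E * (ℓ * ℓ))) ≡ 1 * (k * C) * (E * E * (ℓ * ℓ))
        ones = ℕ-Solver.solve-∀
        square : ∀ a b T ℓ → a * a * (b * T * (b * T) * (ℓ * ℓ)) ≡ a * b * T * ℓ * (a * b * T * ℓ * 1)
        square = ℕ-Solver.solve-∀

      -- The tree spine of the largest height for which the instances fit into
      -- n vertices.
      root-bound : n ≤ (c₂ * T * ℓ) ^ 2
      root-bound with k * (C * (1 * 1 * (ℓ * ℓ))) ℕ.≤? n
      -- Not even a single column fits: n is less than a constant times ℓ², and one round is enough
      -- for the bound.
      ... | no ¬small = square-bound 1 (ℕ.*-mono-≤ (ℕ.*-mono-≤ {1} {3} (s≤s z≤n) 1≤d) 1≤T) (ℕ.<⇒≤ (ℕ.≰⇒> ¬small))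
      ... | yes small with threshold (λ h → k * (C * (d ^ h * d ^ h * (ℓ * ℓ))) ℕ.≤? n) small n large
        where
        open ℕ.≤-Reasoning
        large : ¬ Small (d ^ n)
        large le = ℕ.<-irrefl refl (begin-strict
          n                                     <⟨ n<2^n n ⟩
          2 ^ n                                 ≤⟨ ℕ.^-monoˡ-≤ n (ℕ.^-monoʳ-≤ 2 (ℕ.*-mono-≤ {1} {8} (s≤s z≤n) 1≤k)) ⟩
          d ^ n                                 ≡⟨ ones (d ^ n) ⟩
          1 * (1 * (d ^ n * 1 * (1 * 1)))
            ≤⟨ ℕ.*-mono-≤ 1≤k (ℕ.*-mono-≤ {1} {C} (s≤s z≤n) (ℕ.*-mono-≤
                 (ℕ.*-monoʳ-≤ (d ^ n) (ℕ.m^n>0 d {{ℕ.>-nonZero 1≤d}} n)) (ℕ.*-mono-≤ 1≤ℓ 1≤ℓ))) ⟩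
          k * (C * (d ^ n * d ^ n * (ℓ * ℓ)))   ≤⟨ le ⟩
          n                                     ∎)
          where
          ones : ∀ a → a ≡ 1 * (1 * (a * 1 * (1 * 1)))
          ones = ℕ-Solver.solve-∀
      -- Height h + 1 fails to fit, which bounds n from above, while height h fits and bounds T from
      -- below; the numbers of columns differ by the factor `d`.
      ... | h , smallʰ , ¬next = square-bound (d ^ suc h) (begin
          d * d ^ h            ≤⟨ ℕ.*-monoʳ-≤ d (L-bound h smallʰ) ⟩
          d * suc (T + T)      ≤⟨ ℕ.*-monoʳ-≤ d (ℕ.+-monoˡ-≤ (T + T) 1≤T) ⟩
          d * (T + (T + T))    ≡⟨ rearrange d T ⟩
          3 * d * T            ∎) (ℕ.<⇒≤ (ℕ.≰⇒> ¬next))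
        where
        open ℕ.≤-Reasoning
        rearrange : ∀ d T → d * (T + (T + T)) ≡ 3 * d * T
        rearrange = ℕ-Solver.solve-∀

      -- The share `c₁` T pays for D, so after subtracting D at least `c₂` T remains for the root.
      combined : √ n /log+ D ≤ ((c₁ + c₂) * T)
      combined = ℕ.≤-trans (proj₁ diameter-bound) (ℕ.*-monoˡ-≤ T (ℕ.m≤m+n c₁ c₂)) ,
        ℕ.≤-trans root-bound (ℕ.^-monoˡ-≤ 2 (ℕ.*-monoˡ-≤ ℓ (ℕ.m+n≤o⇒m≤o∸n (c₂ * T) (begin
          c₂ * T + D           ≤⟨ ℕ.+-monoʳ-≤ (c₂ * T) (proj₁ diameter-bound) ⟩
          c₂ * T + c₁ * T      ≡⟨ rearrange c₁ c₂ T ⟩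
          (c₁ + c₂) * T        ∎))))
        where
        open ℕ.≤-Reasoning
        rearrange : ∀ a b T → b * T + a * T ≡ (a + b) * T
        rearrange = ℕ-Solver.solve-∀

  lower-bound : ∀ {Π} → Revealing Π → LowerBound Π
  -- For k = 0 the condition on D forces log n = 0, which n ≥ 2 excludes.
  lower-bound revealing β zero = 0 , 2 , λ n D T r 2≤n log≤0 _ _ _ →
    contradiction (ℕ.≤-trans (⌈log₂⌉-mono-≤ 2≤n) log≤0) λ ()
  lower-bound revealing β k@(suc _) = c₁ + c₂ , n₀ , λ n D T r n₀≤n logD spare A solves →
    combined n₀≤n logD spare A solves
    where open Bounds revealing β k

open Reduction using (lower-bound; RPaths-revealing; 2-SiSP-revealing; ApproxRPaths-revealing; Approx2-SiSP-revealing)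

open import Data.Rational using (ℚ; 1ℚ; _<_)

theorem3 : (LowerBound RPaths × LowerBound 2-SiSP) ×
    ((α : ℚ) → 1ℚ < α → LowerBound (ApproxRPaths α) × LowerBound (Approx2-SiSP α))
theorem3 = (lower-bound RPaths-revealing , lower-bound 2-SiSP-revealing) ,
  λ α _ → lower-bound (ApproxRPaths-revealing α) , lower-bound (Approx2-SiSP-revealing α)
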